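{- There is an algorithm that, given documents $T_1,\dots,T_m$ of total length $n$ over $\Sigma=\{1,\dots,\sigma\}$, an integer $d$ with $2\le d\le m$, and a parameter $\tau$ with $1\le \tau\le n$, runs in $\mathcal{O}(n^2/\tau)$ time and $\mathcal{O}(1)$ space and outputs a string which is a substring of at least $d$ of the documents and has length at least $|LCS|-\tau+1$.
   Context: Longest common substring (LCS) problem: given $m$ strings (documents) $T_1,\dots,T_m$ over an integer alphabet $\Sigma=\{1,2,\dots,\sigma\}$ with $\sigma=n^{\mathcal{O}(1)}$, where $n=\sum_i|T_i|$, and an integer $2\le d\le m$, $LCS$ denotes a longest string that occurs as a substring in at least $d$ of the documents, and $|LCS|$ is its length. Model: word-RAM with word size $w=\Theta(\log n)$ bits; space is measured in machine words (input is read-only and not counted). An output string is reported as a pair of integers specifying a substring of the input. -}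

module Defs where

open import Data.Bool.Base using (Bool; _∧_; _∨_; _xor_; if_then_else_)
open import Data.List.Base using (List; []; _∷_; _++_; length; map; concat; filter; take; drop; replicate)
open import Data.List.Relation.Binary.Infix.Heterogeneous using (Infix)
open import Data.List.Relation.Binary.Infix.Heterogeneous.Properties using (infix?)
open import Data.Maybe.Base using (Maybe; just; nothing; _>>=_)
open import Data.Nat.Base
open import Data.Nat.DivMod using (_/_; _%_)
open import Data.Nat.Logarithm using (⌈log₂_⌉)
open import Data.Nat.Properties using (_≟_; m^n≢0)
open import Data.Product.Base using (_×_; _,_)
open import Data.Sum.Base using (_⊎_; inj₁; inj₂)
open import Relation.Binary.Definitions using (Decidable)
open import Relation.Binary.PropositionalEquality.Core using (_≡_)

Str : Set
Str = List ℕ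

Docs : Set
Docs = List Str

totalLength : Docs → ℕ
totalLength docs = length (concat docs)

_IsSubstringOf_ : Str → Str → Set
_IsSubstringOf_ = Infix _≡_

_isSubstringOf?_ : Decidable _IsSubstringOf_
_isSubstringOf?_ = infix? _≟_

-- Documents are counted with multiplicity: equal strings at different
-- indices are different documents.
OccursInAtLeast : ℕ → Docs → Str → Set
OccursInAtLeast d docs s = d ≤ length (filter (s isSubstringOf?_) docs)

IsLCS : ℕ → Docs → Str → Set
IsLCS d docs s =
  OccursInAtLeast d docs s ×
  (∀ s′ → OccursInAtLeast d docs s′ → length s′ ≤ length s)

-- The pair (b , ℓ) specifies the ℓ letters of T₁T₂⋯Tₘ starting at the 0-based
-- position b; this is a genuine position only if b + ℓ ≤ totalLength docs.
substringAt : Docs → ℕ × ℕ → Str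
substringAt docs (b , ℓ) = take ℓ (drop b (concat docs))

-- Word RAM with word size w.  Every word holds a number below 2 ^ w; an
-- operation takes unit time and its result is reduced modulo 2 ^ w.

Word : Set
Word = ℕ

truncate : ℕ → ℕ → Word
truncate w x = _%_ x (2 ^ w) {{m^n≢0 2 w}}

data Op : Set where
  add sub mul div mod and or xor shl shr : Op

bitwise : (Bool → Bool → Bool) → ℕ → Word → Word → Word
bitwise f zero    x y = 0
bitwise f (suc w) x y =
  (if f (x % 2 ≡ᵇ 1) (y % 2 ≡ᵇ 1) then 1 else 0) + 2 * bitwise f w (x / 2) (y / 2)

-- 2 ^ w is added in sub so that the difference
-- modulo 2 ^ w survives truncated subtraction.  x / 0 and x % 0 are set to 0.
apply : Op → ℕ → Word → Word → ℕ
apply add w x y       = x + y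
apply sub w x y       = (x + 2 ^ w) ∸ y
apply mul w x y       = x * y
apply div w x zero    = 0
apply div w x (suc y) = x / suc y
apply mod w x zero    = 0
apply mod w x (suc y) = x % suc y
apply and w x y       = bitwise _∧_ w x y
apply or  w x y       = bitwise _∨_ w x y
apply xor w x y       = bitwise _xor_ w x y
apply shl w x y       = x * 2 ^ y
apply shr w x y       = _/_ x (2 ^ y) {{m^n≢0 2 y}}

Addr Label : Set
Addr  = ℕ
Label = ℕ

data Instr : Set where
  const : Addr → ℕ → Instr
  op    : Op → Addr → Addr → Addr → Instr
  load  : Addr → Addr → Instr
  store : Addr → Addr → Instr
  read  : Addr → Addr → Instr
  jump  : Label → Instr
  jeq   : Addr → Addr → Label → Instr
  jlt   : Addr → Addr → Label → Instr
  halt  : Addr → Addr → Instr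

Program : Set
Program = List Instr

_‼_ : ∀ {A : Set} → List A → ℕ → Maybe A
[]       ‼ i     = nothing
(x ∷ xs) ‼ zero  = just x
(x ∷ xs) ‼ suc i = xs ‼ i

_[_≔_] : List Word → Addr → Word → Maybe (List Word)
[]       [ i     ≔ v ] = nothing
(x ∷ xs) [ zero  ≔ v ] = just (v ∷ xs)
(x ∷ xs) [ suc i ≔ v ] = (xs [ i ≔ v ]) >>= λ ys → just (x ∷ ys)

record State : Set where
  constructor ⟨_,_⟩
  field
    pc  : Label
    mem : List Word

-- One instruction leads to a new state or halts with a pair of words.  The
-- value nothing is a fault: an access outside the memory, input or program.
module _ (w : ℕ) (P : Program) (input : List Word) where

  exec : Instr → Label → List Word → Maybe (State ⊎ (Word × Word))
  exec (const i k) pc M = do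
    M′ ← M [ i ≔ truncate w k ]
    just (inj₁ ⟨ suc pc , M′ ⟩)
  exec (op o i j k) pc M = do
    x  ← M ‼ j
    y  ← M ‼ k
    M′ ← M [ i ≔ truncate w (apply o w x y) ]
    just (inj₁ ⟨ suc pc , M′ ⟩)
  exec (load i j) pc M = do
    a  ← M ‼ j
    x  ← M ‼ a
    M′ ← M [ i ≔ x ]
    just (inj₁ ⟨ suc pc , M′ ⟩)
  exec (store i j) pc M = do
    a  ← M ‼ i
    x  ← M ‼ j
    M′ ← M [ a ≔ x ]
    just (inj₁ ⟨ suc pc , M′ ⟩)
  exec (read i j) pc M = do
    a  ← M ‼ j
    x  ← input ‼ a
    M′ ← M [ i ≔ x ]
    just (inj₁ ⟨ suc pc , M′ ⟩)
  exec (jump l) pc M = just (inj₁ ⟨ l , M ⟩)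
  exec (jeq i j l) pc M = do
    x ← M ‼ i
    y ← M ‼ j
    just (inj₁ ⟨ (if x ≡ᵇ y then l else suc pc) , M ⟩)
  exec (jlt i j l) pc M = do
    x ← M ‼ i
    y ← M ‼ j
    just (inj₁ ⟨ (if x <ᵇ y then l else suc pc) , M ⟩)
  exec (halt i j) pc M = do
    x ← M ‼ i
    y ← M ‼ j
    just (inj₂ (x , y))

  step : State → Maybe (State ⊎ (Word × Word))
  step ⟨ pc , M ⟩ = (P ‼ pc) >>= λ c → exec c pc M

  data _⇓[_]_ : State → ℕ → Word × Word → Set where
    halts : ∀ {s out} → step s ≡ just (inj₂ out) → s ⇓[ 1 ] out
    steps : ∀ {s s′ t out} → step s ≡ just (inj₁ s′) → s′ ⇓[ t ] out → s ⇓[ suc t ] out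

-- Words of size w, S words of work memory (initially zero), exactly t
-- executed instructions, no fault.
Computes : ℕ → Program → List Word → (S t : ℕ) → Word × Word → Set
Computes w P input S t out = _⇓[_]_ w P input ⟨ 0 , replicate S 0 ⟩ t out

-- The read-only input: n, m, d, τ, |T₁|, …, |Tₘ|, followed by T₁T₂⋯Tₘ.
encode : Docs → (d τ : ℕ) → List Word
encode docs d τ =
  totalLength docs ∷ length docs ∷ d ∷ τ ∷ map length docs ++ concat docs

-- w = Θ(log n): words can address the input and hold a letter of the
-- alphabet (so w ≥ log₂ n), and w ≤ κ log n.
WordSize : (κ σ w : ℕ) → Docs → (d τ : ℕ) → Set
WordSize κ σ w docs d τ =
  length (encode docs d τ) ≤ 2 ^ w × σ < 2 ^ w × w ≤ κ * ⌈log₂ totalLength docs ⌉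

{-# OPTIONS --safe #-}

-- The algorithm samples the text T₁⋯Tₘ at the multiples of h = ⌈τ/2⌉ and lets a candidate length ℓ grow in
-- steps of h.  At the sampled position X it asks whether the window of length ℓ + h at X occurs in at least d
-- documents; if so, the window becomes the new output, otherwise X advances by h.  Every question increases
-- X + ℓ by h, so at most n / h questions are asked.  An occurrence of a longest common substring of length at least
-- ℓ + 2h - 1 contains a window of length ℓ + h at a sampled position, which bounds the error by 2h - 2 ≤ τ - 1.
--
-- A question is answered in time O(n) and constant space by matching the window against each document with
-- Crochemore's algorithm: the maximal suffix of the matched prefix and its period are maintained during the
-- comparisons.  After a mismatch, either this period is a period of the whole matched prefix, which can then
-- be shifted by it and partly kept, or the periods of the matched prefix exceed a third of its length.
module Submission where

open import Defs
open import Data.Bool.Base using (true; false)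
open import Data.Empty using (⊥; ⊥-elim)
open import Data.List.Base using (List; []; _∷_; [_]; _++_; length; map; concat; filter; take; drop; replicate)
open import Data.List.Properties using (length-take; length-drop; concat-++; length-++; length-map; filter-++; filter-accept; filter-reject; filter-all; ++-assoc; ++-identityʳ)
open import Data.List.Relation.Binary.Infix.Heterogeneous using (here; there; _++ⁱ_; _ⁱ++_)
import Data.List.Relation.Binary.Infix.Heterogeneous.Properties as Infix
open import Data.List.Relation.Binary.Prefix.Heterogeneous as Prefix using (Prefix)
open import Data.List.Relation.Unary.All using (All; universal)
open import Data.Maybe.Base using (Maybe; just; nothing; _>>=_)
open import Data.Nat.Base using (ℕ; zero; suc; pred; _+_; _*_; _∸_; _^_; _⊓_; _≤_; _<_; _≡ᵇ_; _<ᵇ_; z≤n; s≤s; s≤s⁻¹; NonZero; >-nonZero)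
open import Data.Nat.DivMod hiding (_div_; _mod_)
open import Data.Nat.Properties
open import Data.Nat.Tactic.RingSolver using (solve)
open import Data.Product.Base using (_×_; _,_; proj₁; proj₂; ∃-syntax; map₁; map₂)
open import Data.Sum.Base using (_⊎_; inj₁; inj₂)
open import Level using (0ℓ)
open import Relation.Binary.Definitions using (tri<; tri≈; tri>)
open import Relation.Binary.PropositionalEquality hiding ([_])
open import Relation.Nullary using (¬_; Dec; yes; no)
open import Relation.Unary using (Pred; Decidable; _⊆_)

-- Maximal suffixes and periods

-- Failure tables would take linear space, so the matcher may remember only a few numbers about the
-- matched prefix. The start `i` and the period `p` of its maximal suffix suffice: every period of
-- the prefix exceeds `i` and is at least `p`, so a period `q` with `3 * q ≤ j` would leave enough
-- room to force `p` to be a period of the whole prefix. Hence the third. Setting `j` back is paid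
-- for by the growth of `i`, and forgetting the prefix by the shift of `y`; the potential
-- `200 * y + 22 * (i + j)` accounts for both. The outer search never returns to a rejected
-- position, because lengthening a string cannot make it occur in more documents. A sampled window
-- may straddle the border of two documents; it is then merely a string, whose occurrences inside
-- single documents are counted like those of any other.

module Words (x : ℕ → ℕ) where

  -- The suffix of x at e is lexicographically smaller than the one at f, with first difference at offset t.
  Below : ℕ → ℕ → ℕ → Set
  Below e f t = (∀ s → s < t → x (e + s) ≡ x (f + s)) × x (e + t) < x (f + t)

  Below-trans : ∀ {e f g t u} → Below e f t → Below f g u → Below e g (t ⊓ u)
  Below-trans {e} {f} {g} {t} {u} (eq , lt) (eq′ , lt′) with <-cmp t u
  ... | tri< t<u _ _ rewrite m≤n⇒m⊓n≡m (<⇒≤ t<u) =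
    (λ s s<t → trans (eq s s<t) (eq′ s (<-trans s<t t<u))) , subst (x (e + t) <_) (eq′ t t<u) lt
  ... | tri≈ _ refl _ rewrite ⊓-idem t =
    (λ s s<t → trans (eq s s<t) (eq′ s s<t)) , <-trans lt lt′
  ... | tri> _ _ u<t rewrite m≥n⇒m⊓n≡n (<⇒≤ u<t) =
    (λ s s<u → trans (eq s (<-trans s<u u<t)) (eq′ s s<u)) , subst (_< x (g + u)) (sym (eq u u<t)) lt′

  Below-cong : ∀ {e e′ f t} → (∀ s → s ≤ t → x (e + s) ≡ x (e′ + s)) → Below e f t → Below e′ f t
  Below-cong {f = f} {t} eq (eq′ , lt) =
    (λ s s<t → trans (sym (eq s (<⇒≤ s<t))) (eq′ s s<t)) , subst (_< x (f + t)) (eq t ≤-refl) lt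

  Period : ℕ → ℕ → Set
  Period q j = ∀ r → r + q < j → x r ≡ x (r + q)

  -- The candidate x[i..j) for the maximal suffix of x[0..j) is a prefix of a power of its prefix w of length p, and
  -- w is a Lyndon word for the reversed alphabet, hence unbordered.  Suffixes starting before i are beaten
  -- within x[0..J); J > j is needed because j is set back whenever i advances.  At that moment the candidate
  -- is empty, which is encoded by p = 0.
  record Factored (J i p j : ℕ) : Set where
    field
      shape    : (p ≡ 0 × i ≡ j) ⊎ (1 ≤ p × i + p ≤ j)
      j≤J      : j ≤ J
      periodic : ∀ r → i ≤ r → r + p < j → x r ≡ x (r + p)
      lyndon   : ∀ r → 1 ≤ r → r < p → ∃[ t ] r + t < p × Below (i + r) i t
      maximal  : ∀ e → e < i → ∃[ t ] i + t < J × Below e i t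

    i≤j : i ≤ j
    i≤j with shape
    ... | inj₁ (_ , refl) = ≤-refl
    ... | inj₂ (_ , i+p≤j) = m+n≤o⇒m≤o i i+p≤j

    i+p≤j : i + p ≤ j
    i+p≤j with shape
    ... | inj₁ (refl , refl) = ≤-reflexive (+-identityʳ i)
    ... | inj₂ (_ , h) = h

    i≢j⇒p>0 : i ≢ j → 1 ≤ p
    i≢j⇒p>0 i≢j with shape
    ... | inj₁ (_ , i≡j) = ⊥-elim (i≢j i≡j)
    ... | inj₂ (p>0 , _) = p>0

    periodic* : ∀ a r → i ≤ r → r + a * p < j → x r ≡ x (r + a * p)
    periodic* zero r _ _ = cong x (sym (+-identityʳ r))
    periodic* (suc a) r i≤r lt =
      trans (periodic r i≤r (≤-<-trans (m≤m+n (r + p) (a * p)) lt′))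
        (trans (periodic* a (r + p) (≤-trans i≤r (m≤m+n r p)) lt′) (cong x (+-assoc r p (a * p))))
      where
      lt′ : r + p + a * p < j
      lt′ = subst (_< j) (sym (+-assoc r p (a * p))) lt

  Factored-start : Factored 0 0 0 0
  Factored-start = record
    { shape = inj₁ (refl , refl) ; j≤J = z≤n ; periodic = λ _ _ () ; lyndon = λ _ _ () ; maximal = λ _ () }

  Factored-mono : ∀ {J J′ i p j} → J ≤ J′ → Factored J i p j → Factored J′ i p j
  Factored-mono J≤J′ F = record
    { shape = shape ; j≤J = ≤-trans j≤J J≤J′ ; periodic = periodic ; lyndon = lyndon
    ; maximal = λ e e<i → map₂ (map₁ (λ lt → ≤-trans lt J≤J′)) (maximal e e<i) }
    where open Factored F

  module _ {J i p j} (F : Factored J i p j) (j<J : j < J) where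
    open Factored F

    -- A single letter is a Lyndon word. Its period 1 is written `suc j ∸ i` because the program
    -- handles this case and that of `Factored-less` by the same block.
    Factored-empty : i ≡ j → Factored J i (suc j ∸ i) (suc j)
    Factored-empty refl rewrite m+n∸n≡m 1 i = record
      { shape = inj₂ (≤-refl , ≤-reflexive (+-comm i 1))
      ; j≤J = j<J
      ; periodic = λ r i≤r lt → ⊥-elim (<⇒≱ (subst (_< suc i) (+-comm r 1) lt) (s≤s i≤r))
      ; lyndon = λ { r 1≤r (s≤s r≤0) → ⊥-elim (<⇒≱ 1≤r r≤0) }
      ; maximal = maximal }

    module _ (i≢j : i ≢ j) where

      private
        instance
          p≢0 : NonZero p
          p≢0 = >-nonZero (i≢j⇒p>0 i≢j)

        p≤j : p ≤ j
        p≤j = m+n≤o⇒n≤o i i+p≤j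

        j-p : j ∸ p + p ≡ j
        j-p = m∸n+n≡m p≤j

      Factored-equal : x j ≡ x (j ∸ p) → Factored J i p (suc j)
      Factored-equal eq = record
        { shape = inj₂ (i≢j⇒p>0 i≢j , ≤-trans i+p≤j (n≤1+n j))
        ; j≤J = j<J
        ; periodic = periodic′
        ; lyndon = lyndon
        ; maximal = maximal }
        where
        periodic′ : ∀ r → i ≤ r → r + p < suc j → x r ≡ x (r + p)
        periodic′ r i≤r (s≤s le) with m≤n⇒m<n∨m≡n le
        ... | inj₁ lt = periodic r i≤r lt
        ... | inj₂ refl = sym (trans eq (cong x (m+n∸n≡m r p)))

      private
        back : ∀ a r → i ≤ r → r + suc a * p ≡ j → x r ≡ x (j ∸ p)
        back a r i≤r eq = trans (periodic* a r i≤r (subst (r + a * p <_) eq (+-monoʳ-< r (m<n+m (a * p) (i≢j⇒p>0 i≢j)))))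
          (cong x (sym (trans (cong (_∸ p) (sym eq)) (trans (cong (λ z → r + z ∸ p) (+-comm p (a * p)))
             (trans (cong (_∸ p) (sym (+-assoc r (a * p) p))) (m+n∸n≡m (r + a * p) p))))))

      -- The candidate now ends with a letter too small to continue the period, and all of it
      -- becomes the new Lyndon word. A suffix starting in a later copy of w falls, because of that
      -- letter, below the suffix that starts whole periods earlier in the first copy, and there w
      -- is Lyndon.
      Factored-less : x j < x (j ∸ p) → Factored J i (suc j ∸ i) (suc j)
      Factored-less lt = record
        { shape = inj₂ (m<n⇒0<n∸m (s≤s i≤j) , ≤-reflexive (m+[n∸m]≡n (≤-trans i≤j (n≤1+n j))))
        ; j≤J = j<J
        ; periodic = λ r i≤r lt′ → ⊥-elim (<⇒≱ lt′ (subst (_≤ r + (suc j ∸ i)) (m+[n∸m]≡n (≤-trans i≤j (n≤1+n j))) (+-monoˡ-≤ _ i≤r)))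
        ; lyndon = lyndon′
        ; maximal = maximal }
        where
        p≤ : p ≤ suc j ∸ i
        p≤ = subst (_≤ suc j ∸ i) (m+n∸m≡n i p) (∸-monoˡ-≤ i (≤-trans i+p≤j (n≤1+n j)))

        -- The suffixes at offsets `r` and `r₀` differ by `suc a` periods, so they agree until the
        -- former reaches position `j`, at distance `t`.
        module Far (a r₀ : ℕ) (ir≤j : i + (r₀ + suc a * p) ≤ j) where
          r t : ℕ
          r = r₀ + suc a * p
          t = j ∸ (i + r)

          i+r+t : i + r + t ≡ j
          i+r+t = m+[n∸m]≡n ir≤j

          swap : ∀ s → i + r₀ + s + suc a * p ≡ i + r + s
          swap s = trans (+-assoc (i + r₀) s (suc a * p)) (trans (cong (i + r₀ +_) (+-comm s (suc a * p)))
            (trans (sym (+-assoc (i + r₀) (suc a * p) s)) (cong (_+ s) (+-assoc i r₀ (suc a * p)))))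

          below : Below (i + r) (i + r₀) t
          below =
            (λ s s<t → sym (trans (periodic* (suc a) (i + r₀ + s) (≤-trans (m≤m+n i r₀) (m≤m+n (i + r₀) s))
                (subst (_< j) (sym (swap s)) (subst (i + r + s <_) i+r+t (+-monoʳ-< (i + r) s<t))))
              (cong x (swap s))))
            , subst₂ _<_ (cong x (sym i+r+t))
                (sym (back a (i + r₀ + t) (≤-trans (m≤m+n i r₀) (m≤m+n (i + r₀) t)) (trans (swap t) i+r+t))) lt

          bound : r + t < suc j ∸ i
          bound = subst (_< suc j ∸ i) (m+n∸m≡n i (r + t))
            (subst (λ z → z ∸ i < suc j ∸ i) (trans (sym i+r+t) (+-assoc i r t)) (∸-monoˡ-< (n<1+n j) i≤j))

        lyndon″ : ∀ a r₀ → r₀ < p → 1 ≤ r₀ + a * p → i + (r₀ + a * p) ≤ j →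
          ∃[ t ] r₀ + a * p + t < suc j ∸ i × Below (i + (r₀ + a * p)) i t
        lyndon″ zero r₀ r₀<p 1≤r _ rewrite +-identityʳ r₀ =
          map₂ (map₁ (λ lt′ → ≤-trans lt′ p≤)) (lyndon r₀ 1≤r r₀<p)
        lyndon″ (suc a) zero r₀<p 1≤r ir≤j =
          t , bound , subst (λ z → Below (i + r) z t) (+-identityʳ i) below
          where open Far a zero ir≤j
        lyndon″ (suc a) (suc r₀) r₀<p 1≤r ir≤j with lyndon (suc r₀) (s≤s z≤n) r₀<p
        ... | t₀ , _ , below₀ = t ⊓ t₀ , ≤-<-trans (+-monoʳ-≤ r (m⊓n≤m t t₀)) bound , Below-trans below below₀
          where open Far a (suc r₀) ir≤j

        lyndon′ : ∀ r → 1 ≤ r → r < suc j ∸ i → ∃[ t ] r + t < suc j ∸ i × Below (i + r) i t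
        lyndon′ r 1≤r lt′ = subst (λ z → ∃[ t ] z + t < suc j ∸ i × Below (i + z) i t) (sym eq)
          (lyndon″ (r / p) (r % p) (m%n<n r p) (subst (1 ≤_) eq 1≤r) (subst (λ z → i + z ≤ j) eq ir≤j))
          where
          eq : r ≡ r % p + r / p * p
          eq = m≡m%n+[m/n]*n r p
          ir≤j : i + r ≤ j
          ir≤j = s≤s⁻¹ (subst (_≤ suc j) (+-suc i r) (subst (i + suc r ≤_) (m+[n∸m]≡n (≤-trans i≤j (n≤1+n j))) (+-monoʳ-≤ i lt′)))

      -- The last, incomplete copy of w (`k` letters, possibly none) followed by the larger letter
      -- `x j` beats w, and with it everything that w beats. So the candidate restarts where this
      -- copy begins. It restarts empty because its own factorisation is not known; the deciding
      -- letter at `j` stays in reach of the witnesses since `j < J`.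
      Factored-greater : ∀ k → k ≡ (j ∸ i) % p → x (j ∸ p) < x j → Factored J (j ∸ k) 0 (j ∸ k)
      Factored-greater k k≡ gt = record
        { shape = inj₁ (refl , refl) ; j≤J = ≤-trans (m∸n≤m j k) j≤J
        ; periodic = λ r le lt → ⊥-elim (<⇒≱ lt (≤-trans le (m≤m+n r 0)))
        ; lyndon = λ _ _ () ; maximal = subst (λ z → ∀ e → e < z → ∃[ t ] z + t < J × Below e z t) i′≡ maximal′ }
        where
        a = (j ∸ i) / p
        i′ = i + a * p

        k<p : k < p
        k<p = subst (_< p) (sym k≡) (m%n<n (j ∸ i) p)

        i′+k : i′ + k ≡ j
        i′+k = trans (+-assoc i (a * p) k) (trans (cong (i +_) (trans (+-comm (a * p) k)
          (trans (cong (_+ a * p) k≡) (sym (m≡m%n+[m/n]*n (j ∸ i) p))))) (m+[n∸m]≡n i≤j))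

        i′≡ : i′ ≡ j ∸ k
        i′≡ = sym (trans (cong (_∸ k) (sym i′+k)) (m+n∸n≡m i′ k))

        i′+k<J : i′ + k < J
        i′+k<J = subst (_< J) (sym i′+k) j<J

        1≤a : 1 ≤ a
        1≤a = m≥n⇒m/n>0 (subst (_≤ j ∸ i) (m+n∸m≡n i p) (∸-monoˡ-≤ i i+p≤j))

        swap : ∀ b s → i + s + b * p ≡ i + b * p + s
        swap b s = trans (+-assoc i s (b * p)) (trans (cong (i +_) (+-comm s (b * p))) (sym (+-assoc i (b * p) s)))

        suc-pred-a : suc (pred a) ≡ a
        suc-pred-a = suc-pred a {{>-nonZero 1≤a}}

        old-below-new : Below i i′ k
        old-below-new =
          (λ s s<k → trans (periodic* a (i + s) (m≤m+n i s)
              (subst (_< j) (sym (swap a s)) (subst (i′ + s <_) i′+k (+-monoʳ-< i′ s<k)))) (cong x (swap a s)))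
          , subst₂ _<_ (sym (back (pred a) (i + k) (m≤m+n i k)
               (trans (cong (λ z → i + k + z * p) suc-pred-a) (trans (swap a k) i′+k)))) (cong x (sym i′+k)) gt

        -- Up to the deciding offset, a start in copy `b` of w looks like the corresponding start in
        -- the first copy. For `r₀ = 0` that is `i` itself, otherwise `lyndon` applies.
        inside : ∀ b r₀ → r₀ < p → b < a → ∃[ t ] i′ + t < J × Below (i + (r₀ + b * p)) i′ t
        inside b zero _ b<a = k , i′+k<J , Below-cong shift old-below-new
          where
          shift : ∀ s → s ≤ k → x (i + s) ≡ x (i + (b * p) + s)
          shift s s≤k = trans (periodic* b (i + s) (m≤m+n i s) (subst (_< j) (sym (swap b s))
            (subst (i + b * p + s <_) i′+k (+-mono-<-≤ (+-monoʳ-< i (*-monoˡ-< p b<a)) s≤k)))) (cong x (swap b s))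
        inside b (suc r₀) r₀<p b<a with lyndon (suc r₀) (s≤s z≤n) r₀<p
        ... | t , r+t<p , below =
          t ⊓ k , ≤-<-trans (+-monoʳ-≤ i′ (m⊓n≤n t k)) i′+k<J , Below-trans (Below-cong shift below) old-below-new
          where
          r = suc r₀
          swap′ : ∀ s → i + r + s + b * p ≡ i + (r + b * p) + s
          swap′ s = trans (+-assoc (i + r) s (b * p)) (trans (cong (i + r +_) (+-comm s (b * p)))
            (trans (sym (+-assoc (i + r) (b * p) s)) (cong (_+ s) (+-assoc i r (b * p)))))
          shift : ∀ s → s ≤ t → x (i + r + s) ≡ x (i + (r + b * p) + s)
          shift s s≤t = trans (periodic* b (i + r + s) (≤-trans (m≤m+n i r) (m≤m+n (i + r) s))
            (<-≤-trans (+-monoˡ-< (b * p) (subst (_< i + p) (sym (+-assoc i r s))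
                (+-monoʳ-< i (≤-<-trans (+-monoʳ-≤ r s≤t) r+t<p))))
              (subst (_≤ j) (sym (+-assoc i p (b * p)))
                (≤-trans (+-monoʳ-≤ i (*-monoˡ-≤ p b<a)) (subst (i′ ≤_) i′+k (m≤m+n i′ k)))))) (cong x (swap′ s))

        maximal′ : ∀ e → e < i′ → ∃[ t ] i′ + t < J × Below e i′ t
        maximal′ e e<i′ with e <? i
        ... | yes e<i with maximal e e<i
        ...   | t , _ , below = t ⊓ k , ≤-<-trans (+-monoʳ-≤ i′ (m⊓n≤n t k)) i′+k<J , Below-trans below old-below-new
        maximal′ e e<i′ | no e≮i = subst (λ z → ∃[ t ] i′ + t < J × Below z i′ t) eq
            (inside (r / p) (r % p) (m%n<n r p) (*-cancelʳ-< p _ _ (≤-<-trans (m/n*n≤m r p) r<ap)))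
          where
          r = e ∸ i
          i+r : i + r ≡ e
          i+r = m+[n∸m]≡n (≮⇒≥ e≮i)
          eq : i + (r % p + r / p * p) ≡ e
          eq = trans (cong (i +_) (sym (m≡m%n+[m/n]*n r p))) i+r
          r<ap : r < a * p
          r<ap = +-cancelˡ-< i _ _ (subst (_< i′) (sym i+r) e<i′)

  module _ {i p j} (F : Factored j i p j) where
    open Factored F

    -- With a period `q ≤ i`, the suffix at `i ∸ q` would repeat the one at `i` up to `j`, but
    -- maximality provides a mismatch before that. This is where `J` has to equal `j`.
    i<period : ∀ q → 1 ≤ q → Period q j → i < q
    i<period q 1≤q per with i <? q
    ... | yes i<q = i<q
    ... | no i≮q with maximal (i ∸ q) (subst (i ∸ q <_) i≡ (m<m+n (i ∸ q) 1≤q))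
      where
      i≡ : i ∸ q + q ≡ i
      i≡ = m∸n+n≡m (≮⇒≥ i≮q)
    ... | t , i+t<j , (_ , lt) = ⊥-elim (<⇒≢ lt (trans (per (i ∸ q + t) (subst (_< j) (sym eq) i+t<j)) (cong x eq)))
      where
      eq : i ∸ q + t + q ≡ i + t
      eq = trans (+-assoc (i ∸ q) t q) (trans (cong (i ∸ q +_) (+-comm t q)) (trans (sym (+-assoc (i ∸ q) q t))
        (cong (_+ t) (m∸n+n≡m (≮⇒≥ i≮q)))))

    -- A period `q < p` would give w a border, and a Lyndon word has none.
    p≤period : ∀ q → 1 ≤ q → Period q j → p ≤ q
    p≤period q 1≤q per with p ≤? q
    ... | yes p≤q = p≤q
    ... | no p≰q with lyndon q 1≤q (≰⇒> p≰q)
    ... | t , q+t<p , (_ , lt) = ⊥-elim (<⇒≢ lt (sym (trans (per (i + t) (subst (_< j) (sym eq) lt′)) (cong x eq))))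
      where
      eq : i + t + q ≡ i + q + t
      eq = trans (+-assoc i t q) (trans (cong (i +_) (+-comm t q)) (sym (+-assoc i q t)))
      lt′ : i + q + t < j
      lt′ = subst (_< j) (sym (+-assoc i q t)) (<-≤-trans (+-monoʳ-< i q+t<p) i+p≤j)

    -- A position before `i` is moved by `q` into the candidate, where `p` is a period, and then
    -- moved back.
    short-period⇒Period-p : ∀ q → i ≤ q → Period q j → i + q + p ≤ j → Period p j
    short-period⇒Period-p q i≤q per le r r+p<j with i ≤? r
    ... | yes i≤r = periodic r i≤r r+p<j
    ... | no i≰r = trans (per r (<-≤-trans (+-monoˡ-< q (≰⇒> i≰r)) (m+n≤o⇒m≤o (i + q) le)))
                   (trans (periodic (r + q) (≤-trans i≤q (m≤n+m q r)) lt)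
                   (trans (cong x eq) (sym (per (r + p) (subst (_< j) eq lt)))))
      where
      lt : r + q + p < j
      lt = <-≤-trans (+-monoˡ-< p (+-monoˡ-< q (≰⇒> i≰r))) le
      eq : r + q + p ≡ r + p + q
      eq = trans (+-assoc r q p) (trans (cong (r +_) (+-comm q p)) (sym (+-assoc r p q)))

    -- For an empty candidate `i ≡ j`, so `i<period` alone excludes a period up to `j`. Otherwise
    -- `3 * q ≤ j` yields `i + q + p ≤ j`.
    aperiodic : (1 ≤ p → ¬ Period p j) → ∀ q → 1 ≤ q → Period q j → suc (j / 3) ≤ q
    aperiodic ¬per q 1≤q per = m<n*o⇒m/o<n (subst₂ _≤_ refl (*-comm 3 q) (≰⇒> λ 3q≤j → no-room 3q≤j))
      where
      no-room : ¬ 3 * q ≤ j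
      no-room 3q≤j with shape
      ... | inj₁ (refl , refl) = <⇒≱ (i<period q 1≤q per) (≤-trans (m≤m+n q _) 3q≤j)
      ... | inj₂ (1≤p , _) = ¬per 1≤p (short-period⇒Period-p q (<⇒≤ (i<period q 1≤q per)) per
              (≤-trans (+-mono-≤ (+-monoˡ-≤ q (<⇒≤ (i<period q 1≤q per))) (p≤period q 1≤q per))
                (≤-trans (≤-reflexive (trans (+-assoc q q q) (cong (λ z → q + (q + z)) (sym (+-identityʳ q))))) 3q≤j)))

    -- By periodicity the mismatches witnessing maximality all lie in the first period.
    Factored-shift : Period p j → i + p ≤ j ∸ p → 1 ≤ p → Factored (j ∸ p) i p (j ∸ p)
    Factored-shift per le 1≤p = record
      { shape = inj₂ (1≤p , le) ; j≤J = ≤-refl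
      ; periodic = λ r i≤r lt → periodic r i≤r (<-≤-trans lt (m∸n≤m j p))
      ; lyndon = lyndon ; maximal = maximal′ }
      where
      maximal′ : ∀ e → e < i → ∃[ t ] i + t < j ∸ p × Below e i t
      maximal′ e e<i with maximal e e<i
      ... | t , i+t<j , below@(eq , lt) with t <? p
      ...   | yes t<p = t , <-≤-trans (+-monoʳ-< i t<p) le , below
      ...   | no t≮p = ⊥-elim (<⇒≢ lt (trans (sym (back e (<-trans (+-monoˡ-< t e<i) i+t<j)))
                         (trans (eq (t ∸ p) (∸-monoʳ-< 1≤p (≮⇒≥ t≮p))) (back i i+t<j))))
        where
        shift : ∀ f → f + (t ∸ p) + p ≡ f + t
        shift f = trans (+-assoc f (t ∸ p) p) (cong (f +_) (m∸n+n≡m (≮⇒≥ t≮p)))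
        back : ∀ f → f + t < j → x (f + (t ∸ p)) ≡ x (f + t)
        back f lt′ = trans (per (f + (t ∸ p)) (subst (_< j) (sym (shift f)) lt′)) (cong x (shift f))

-- Linear arithmetic: l ≤ r is a combination of hypotheses and s the slack, so that a semiring identity remains.
linear : ∀ {l r a b} s → l ≤ r → a + r + s ≡ b + l → a ≤ b
linear {l} {r} {a} {b} s l≤r eq =
  +-cancelʳ-≤ r a b (≤-trans (m≤m+n (a + r) s) (≤-trans (≤-reflexive eq) (+-monoʳ-≤ b l≤r)))

infixr 7 _·_
infixl 6 _⊕_
_·_ : ∀ {l r} c → l ≤ r → c * l ≤ c * r
c · h = *-monoʳ-≤ c h
_⊕_ : ∀ {l r l′ r′} → l ≤ r → l′ ≤ r′ → l + l′ ≤ r + r′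
_⊕_ = +-mono-≤
lt : ∀ {a b} → a < b → 1 + a ≤ b
lt h = h

-- Amortised running time

cost-step : ∀ y i j t → t ≤ 22 → t + (200 * y + 22 * (i + j)) ≤ (200 * y + 22 * (i + (j + 1)))
cost-step y i j t t≤ = linear 0 t≤ (solve (y ∷ i ∷ j ∷ t ∷ []))

-- `i` gains at least `p` while `j` loses only `k < p`, so `i + j` still grows. A rewind takes 22
-- instructions, the most among the iterations that keep `y`; this is the factor 22 of the
-- potential.
cost-rewind : ∀ y i p j i′ k → i + p ≤ i′ → k < p → i′ + k ≡ j → 22 + (200 * y + 22 * (i + j)) ≤ (200 * y + 22 * (i′ + (i′ + 0)))
cost-rewind y i p _ i′ k le k<p refl = linear 0 (22 · le ⊕ 22 · lt k<p) (solve (y ∷ i ∷ p ∷ i′ ∷ k ∷ []))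

-- The shift has to pay for the loss of `i + j` and for a test of up to `i` letters at 11
-- instructions each. As `i ≤ j < 3 * s`, a factor of 165 suffices; 200 is a rounded value.
cost-aperiodic : ∀ y i j s t → t ≤ 29 + 11 * i → i ≤ j → j < s * 3 → t + (200 * y + 22 * (i + j)) ≤ (200 * (y + s) + 22 * (0 + 0))
cost-aperiodic y i j s t t≤ i≤j j<3s =
  linear (35 * s + 26) (t≤ ⊕ 33 · i≤j ⊕ 55 · lt j<3s) (solve (y ∷ i ∷ j ∷ s ∷ t ∷ []))

cost-keep : ∀ y i p j j′ t → t ≤ 28 + 11 * i → i < p → j′ + p ≡ j → t + (200 * y + 22 * (i + j)) ≤ (200 * (y + p) + 22 * (i + j′))
cost-keep y i p _ j′ t t≤ i<p refl =
  linear (17 * i + 150 * p) (t≤ ⊕ 28 · lt i<p) (solve (y ∷ i ∷ p ∷ j′ ∷ t ∷ []))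

cost-drop : ∀ y i p j j′ t → t ≤ 28 + 11 * i → i < p → j′ + p ≡ j → j′ < i + p → t + (200 * y + 22 * (i + j)) ≤ (200 * (y + p) + 22 * (0 + 0))
cost-drop y i p _ j′ t t≤ i<p refl j′< =
  linear (101 * p + 49) (t≤ ⊕ 55 · lt i<p ⊕ 22 · lt j′<) (solve (y ∷ i ∷ p ∷ j′ ∷ t ∷ []))


-- Within a document `y` contributes at most `200 * len` to the potential and `i + j` at most
-- `22 * (K + K)`; hence 244 = 200 + 44.
cost-document : ∀ t Y len K z → z ≡ Y + len → t + 200 * Y ≤ 200 * z + 22 * (K + K) + 5 → K ≤ len →
  6 + (t + 5) ≤ 244 * len + 16
cost-document t Y len K _ refl t≤ K≤len = linear 0 (t≤ ⊕ 44 · K≤len) (solve (t ∷ Y ∷ len ∷ K ∷ []))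

cost-documents : ∀ len m t total → t ≤ 244 * len + 16 → ∀ t′ → t′ ≤ 244 * total + 16 * m + 1 →
  t + t′ ≤ 244 * (len + total) + 16 * (1 + m) + 1
cost-documents len m t total t≤ t′ t′≤ = linear 0 (t≤ ⊕ t′≤) (solve (len ∷ m ∷ t ∷ total ∷ t′ ∷ []))

cost-iteration : ∀ t n m → t ≤ 244 * n + 16 * m + 1 → m ≤ n → 6 + (t + 5) ≤ 260 * n + 12
cost-iteration t n m t≤ m≤n = linear 0 (t≤ ⊕ 16 · m≤n) (solve (t ∷ n ∷ m ∷ []))

2*-assoc : ∀ k c h → k * c * (h * 2) ≡ 2 * c * (k * h)
2*-assoc k c h = solve (k ∷ c ∷ h ∷ [])

cost-square : ∀ n N → n ≤ N → 16 * N + 2 * (260 * N + 12 * n) ≤ 560 * N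
cost-square n N n≤N = linear 0 (24 · n≤N) (solve (n ∷ N ∷ []))

-- The bound O(n²/τ) without division. Here `k` is the number of questions, and 560 = 2 * (260 + 12)
-- + 16.
cost-total : ∀ {t k h n τ} → t ≤ k * (260 * n + 12) + 16 → k * h ≤ n → τ ≤ h * 2 → τ ≤ n → 1 ≤ n →
  t * τ ≤ 560 * (n * n)
cost-total {t} {k} {h} {n} {τ} t≤ kh≤n τ≤2h τ≤n 1≤n = begin
  t * τ                                    ≤⟨ *-monoˡ-≤ τ t≤ ⟩
  (k * c + 16) * τ                         ≡⟨ *-distribʳ-+ τ (k * c) 16 ⟩
  k * c * τ + 16 * τ                       ≤⟨ +-mono-≤ (*-monoʳ-≤ (k * c) τ≤2h) (*-monoʳ-≤ 16 (≤-trans τ≤n n≤n²)) ⟩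
  k * c * (h * 2) + 16 * (n * n)           ≡⟨ cong (_+ 16 * (n * n)) (2*-assoc k c h) ⟩
  2 * c * (k * h) + 16 * (n * n)           ≤⟨ +-monoˡ-≤ (16 * (n * n)) (*-monoʳ-≤ (2 * c) kh≤n) ⟩
  2 * c * n + 16 * (n * n)                 ≡⟨ +-comm (2 * c * n) (16 * (n * n)) ⟩
  16 * (n * n) + 2 * c * n                 ≡⟨ cong (16 * (n * n) +_) (trans (*-assoc 2 c n) (cong (2 *_)
                                                (trans (*-distribʳ-+ n (260 * n) 12) (cong (_+ 12 * n) (*-assoc 260 n n))))) ⟩
  16 * (n * n) + 2 * (260 * (n * n) + 12 * n) ≤⟨ cost-square n (n * n) n≤n² ⟩
  560 * (n * n)                            ∎
  where
  open ≤-Reasoning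
  c : ℕ
  c = 260 * n + 12
  n≤n² : n ≤ n * n
  n≤n² = ≤-trans (≤-reflexive (sym (*-identityˡ n))) (*-monoˡ-≤ n 1≤n)

-- A sampled position lies at most `h ∸ 1` after the start `p` of an occurrence, so `h ∸ 1 + h ≤ τ`
-- letters beyond `ℓ` are enough.
window-fits : ∀ x h p ℓ τ L → x + 1 ≤ p + h → h * 2 ≤ τ + 1 → ℓ + τ ≤ L → x + (ℓ + h) ≤ p + L
window-fits x h p ℓ τ L x< 2h≤ ℓ+τ≤ = linear 0 (x< ⊕ 2h≤ ⊕ ℓ+τ≤) (solve (x ∷ h ∷ p ∷ ℓ ∷ τ ∷ L ∷ []))

-- The program

-- Addresses in program: compareL, testLoopL, testCompareL and testNextL lie inside the blocks search and test,
-- all others are starts of blocks.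
outerL docL resetL searchL compareL aperiodicL testL testLoopL testCompareL testNextL periodicL sameL newL extendL
  foundL nextL countedL failL haltL : Label
outerL = 14
docL = 20
resetL = 26
searchL = 29
compareL = 37
aperiodicL = 39
testL = 44
testLoopL = 45
testCompareL = 53
testNextL = 55
periodicL = 57
sameL = 62
newL = 75
extendL = 78
foundL = 80
nextL = 81
countedL = 85
failL = 90
haltL = 92

module Code where
  private
    -- Addresses 0 to 15 hold the fields of `Frame` together with the constant 1, the others the
    -- variables of the matcher and its scratch words; `mem` has the same layout.
    N BASE D H ONE R X ℓ BEST K A Y CNT LEN Z E y i p j r u v c e : ℕ
    N = 0
    BASE = 1
    D = 2
    H = 3
    ONE = 4
    R = 5
    X = 6
    ℓ = 7
    BEST = 8
    K = 9
    A = 10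
    Y = 11
    CNT = 12
    LEN = 13
    Z = 14
    E = 15
    y = 16
    i = 17
    p = 18
    j = 19
    r = 20
    u = 21
    v = 22
    c = 23
    e = 24

  initialise outerLoop docLoop reset search aperiodic test periodic same new extend found next counted fail finish : Program
  initialise =
    const ONE 1 ∷ read N u ∷ read R u ∷ read BASE ONE ∷ const u 2 ∷ read D u ∷ const u 3 ∷ read H u ∷
    const u 4 ∷ op add BASE BASE u ∷ op add H H ONE ∷ const u 2 ∷ op div H H u ∷ const u 0 ∷ []
  outerLoop =
    jlt R H haltL ∷ op sub R R H ∷ op add K ℓ H ∷ const A 4 ∷ const Y 0 ∷ const CNT 0 ∷ []
  docLoop =
    jeq A BASE countedL ∷ read LEN A ∷ op add Z Y LEN ∷ jlt LEN K nextL ∷ op sub E Z K ∷ op sub y Z LEN ∷ []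
  reset =
    const i 0 ∷ const p 0 ∷ const j 0 ∷ []
  search =
    jlt E y nextL ∷ jeq j K foundL ∷
    op add u X j ∷ op add u BASE u ∷ read c u ∷
    op add v y j ∷ op add v BASE v ∷ read e v ∷
    -- If `p ≤ i`, then `p` is no period of the matched prefix by `i<period`, and the test is
    -- skipped.
    jeq c e sameL ∷ jlt i p testL ∷ []
  aperiodic =
    const u 3 ∷ op div u j u ∷ op add u u ONE ∷ op add y y u ∷ jump resetL ∷ []
  -- From `i` on the period `p` is already known, so only the first `i` letters are compared.
  test =
    const r 0 ∷
    jeq r i periodicL ∷
    op add u X r ∷ op add u BASE u ∷ read c u ∷
    op add v r p ∷ op add v X v ∷ op add v BASE v ∷ read e v ∷
    jeq c e testNextL ∷ jump aperiodicL ∷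
    op add r r ONE ∷ jump testLoopL ∷ []
  periodic =
    op add y y p ∷ op sub j j p ∷ op add u i p ∷ jlt j u resetL ∷ jump searchL ∷ []
  same =
    jeq i j newL ∷
    op sub u j p ∷ op add u X u ∷ op add u BASE u ∷ read e u ∷
    jeq c e extendL ∷ jlt c e newL ∷
    op sub u j i ∷ op mod u u p ∷ op sub i j u ∷ const p 0 ∷ op add j i p ∷ jump searchL ∷ []
  new =
    op add j j ONE ∷ op sub p j i ∷ jump searchL ∷ []
  extend =
    op add j j ONE ∷ jump searchL ∷ []
  found =
    op add CNT CNT ONE ∷ []
  -- There is no move instruction, so words are copied by adding 0. This is the origin of terms such
  -- as `Z + 0` and `K + 0` in the proofs; likewise `same` copies `i` to `j` by adding the `p` it
  -- has just cleared.
  next =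
    const u 0 ∷ op add Y Z u ∷ op add A A ONE ∷ jump docL ∷ []
  counted =
    jlt CNT D failL ∷ const u 0 ∷ op add ℓ K u ∷ op add BEST X u ∷ jump outerL ∷ []
  fail =
    op add X X H ∷ jump outerL ∷ []
  finish =
    halt BEST ℓ ∷ []

  program : Program
  program = initialise ++ outerLoop ++ docLoop ++ reset ++ search ++ aperiodic ++ test ++ periodic ++
    same ++ new ++ extend ++ found ++ next ++ counted ++ fail ++ finish

open Code using (program)

-- Symbolic execution of programs

module Exec (w : ℕ) (P : Program) (input : List Word) where

  infixr 5 _◅_ _◅◅_

  data _⟶[_]_ : State → ℕ → State → Set where
    ε   : ∀ {s} → s ⟶[ 0 ] s
    _◅_ : ∀ {s s′ s″ t} → step w P input s ≡ just (inj₁ s′) → s′ ⟶[ t ] s″ → s ⟶[ suc t ] s″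

  _◅◅_ : ∀ {s s′ s″ t t′} → s ⟶[ t ] s′ → s′ ⟶[ t′ ] s″ → s ⟶[ t + t′ ] s″
  ε        ◅◅ qs = qs
  (q ◅ qs) ◅◅ rs = q ◅ (qs ◅◅ rs)

  ⟶-⇓ : ∀ {s s′ t t′ out} → s ⟶[ t ] s′ → _⇓[_]_ w P input s′ t′ out → _⇓[_]_ w P input s (t + t′) out
  ⟶-⇓ ε        h = h
  ⟶-⇓ (q ◅ qs) h = steps q (⟶-⇓ qs h)

  OnJust : {A : Set} → Maybe A → (A → Set) → Set
  OnJust nothing  K = ⊥
  OnJust (just x) K = K x

  -- Symbolic execution: Path k s s′ computes to a nested product of the side conditions (values without
  -- overflow, letters read, outcomes of the tests) under which k instructions lead from s to s′.
  After : Instr → Label → List Word → (State → Set) → Set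
  After (const i k)  pc M Q = ∃[ z ] truncate w k ≡ z × OnJust (M [ i ≔ z ]) λ M′ → Q ⟨ suc pc , M′ ⟩
  After (op o i j k) pc M Q = OnJust (M ‼ j) λ x → OnJust (M ‼ k) λ y →
    ∃[ z ] truncate w (apply o w x y) ≡ z × OnJust (M [ i ≔ z ]) λ M′ → Q ⟨ suc pc , M′ ⟩
  After (read i j)   pc M Q = OnJust (M ‼ j) λ a →
    ∃[ z ] input ‼ a ≡ just z × OnJust (M [ i ≔ z ]) λ M′ → Q ⟨ suc pc , M′ ⟩
  After (jump l)     pc M Q = Q ⟨ l , M ⟩
  After (jeq i j l)  pc M Q = OnJust (M ‼ i) λ x → OnJust (M ‼ j) λ y →
    (x ≡ y × Q ⟨ l , M ⟩) ⊎ (x ≢ y × Q ⟨ suc pc , M ⟩)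
  After (jlt i j l)  pc M Q = OnJust (M ‼ i) λ x → OnJust (M ‼ j) λ y →
    (x < y × Q ⟨ l , M ⟩) ⊎ (y ≤ x × Q ⟨ suc pc , M ⟩)
  After _            pc M Q = ⊥

  Path : ℕ → State → State → Set
  Path zero    s          s′ = s ≡ s′
  Path (suc k) ⟨ pc , M ⟩ s′ = OnJust (P ‼ pc) λ ins → After ins pc M λ s → Path k s s′

  private
    assign-sound : ∀ {M i z pc} {Q : State → Set} → OnJust (M [ i ≔ z ]) (λ M′ → Q ⟨ suc pc , M′ ⟩) →
      ∃[ s ] ((M [ i ≔ z ]) >>= λ M′ → just (inj₁ ⟨ suc pc , M′ ⟩)) ≡ just (inj₁ {B = Word × Word} s) × Q s
    assign-sound {M} {i} {z} h with M [ i ≔ z ]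
    ... | just _ = _ , refl , h

    After-sound : ∀ ins pc M {Q : State → Set} → After ins pc M Q → ∃[ s ] exec w P input ins pc M ≡ just (inj₁ s) × Q s
    After-sound (const i k) pc M {Q} (_ , refl , h) = assign-sound {M} {i} {Q = Q} h
    After-sound (op o i j k) pc M {Q} h with M ‼ j
    ... | just _ with M ‼ k
    After-sound (op o i j k) pc M {Q} (_ , refl , h) | just _ | just _ = assign-sound {M} {i} {Q = Q} h
    After-sound (read i j) pc M {Q} h with M ‼ j
    After-sound (read i j) pc M {Q} (z , eq , h) | just a rewrite eq = assign-sound {M} {i} {Q = Q} h
    After-sound (jump l) pc M h = _ , refl , h
    After-sound (jeq i j l) pc M h with M ‼ i
    ... | just x with M ‼ j
    After-sound (jeq i j l) pc M (inj₁ (x≡y , h)) | just x | just y with x ≡ᵇ y | ≡⇒≡ᵇ x y x≡y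
    ... | true | _ = _ , refl , h
    After-sound (jeq i j l) pc M (inj₂ (x≢y , h)) | just x | just y with x ≡ᵇ y | ≡ᵇ⇒≡ x y
    ... | true | f = ⊥-elim (x≢y (f _))
    ... | false | _ = _ , refl , h
    After-sound (jlt i j l) pc M h with M ‼ i
    ... | just x with M ‼ j
    After-sound (jlt i j l) pc M (inj₁ (x<y , h)) | just x | just y with x <ᵇ y | <⇒<ᵇ x<y
    ... | true | _ = _ , refl , h
    After-sound (jlt i j l) pc M (inj₂ (y≤x , h)) | just x | just y with x <ᵇ y | <ᵇ⇒< x y
    ... | true | f = ⊥-elim (<⇒≱ (f _) y≤x)
    ... | false | _ = _ , refl , h

  run : ∀ k {s s′} → Path k s s′ → s ⟶[ k ] s′
  run zero refl = ε
  run (suc k) {⟨ pc , M ⟩} path with P ‼ pc in fetch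
  ... | just ins with After-sound ins pc M path
  ...   | s , eq , path′ = trans (cong (_>>= λ ins′ → exec w P input ins′ pc M) fetch) eq ◅ run k path′

-- Word arithmetic without overflow

module _ (w : ℕ) where
  private instance
    2^w≢0 : NonZero (2 ^ w)
    2^w≢0 = m^n≢0 2 w

  truncate-id : ∀ {x} → x < 2 ^ w → truncate w x ≡ x
  truncate-id = m<n⇒m%n≡m

  sub-id : ∀ {x y} → x < 2 ^ w → y ≤ x → truncate w (apply sub w x y) ≡ x ∸ y
  sub-id {x} {y} x< y≤x = trans (cong (truncate w) (+-∸-comm (2 ^ w) y≤x))
    (trans ([m+n]%n≡m%n (x ∸ y) (2 ^ w)) (m<n⇒m%n≡m (≤-<-trans (m∸n≤m x y) x<)))

  div-id : ∀ {x y} .{{_ : NonZero y}} → x < 2 ^ w → truncate w (apply div w x y) ≡ x / y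
  div-id {x} {suc y} x< = m<n⇒m%n≡m (≤-<-trans (m/n≤m x (suc y)) x<)

  mod-id : ∀ {x y} .{{_ : NonZero y}} → x < 2 ^ w → truncate w (apply mod w x y) ≡ x % y
  mod-id {x} {suc y} x< = m<n⇒m%n≡m (≤-<-trans (m%n≤m x (suc y)) x<)

-- Substrings by positions

-- Outside the string the value is 0.
letter : Str → ℕ → ℕ
letter []       k       = 0
letter (a ∷ as) zero    = a
letter (a ∷ as) (suc k) = letter as k

letter-++ˡ : ∀ s s′ k → k < length s → letter (s ++ s′) k ≡ letter s k
letter-++ˡ (a ∷ s) s′ zero    _        = refl
letter-++ˡ (a ∷ s) s′ (suc k) (s≤s lt) = letter-++ˡ s s′ k lt

letter-++ʳ : ∀ s s′ k → letter (s ++ s′) (length s + k) ≡ letter s′ k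
letter-++ʳ []      s′ k = refl
letter-++ʳ (a ∷ s) s′ k = letter-++ʳ s s′ k

letter-take : ∀ ℓ s k → k < ℓ → letter (take ℓ s) k ≡ letter s k
letter-take (suc ℓ) []      k       _        = refl
letter-take (suc ℓ) (a ∷ s) zero    _        = refl
letter-take (suc ℓ) (a ∷ s) (suc k) (s≤s lt) = letter-take ℓ s k lt

letter-drop : ∀ b s k → letter (drop b s) k ≡ letter s (b + k)
letter-drop zero    s       k = refl
letter-drop (suc b) []      k = refl
letter-drop (suc b) (a ∷ s) k = letter-drop b s k

‼-letter : ∀ s k → k < length s → s ‼ k ≡ just (letter s k)
‼-letter (a ∷ s) zero    _        = refl
‼-letter (a ∷ s) (suc k) (s≤s lt) = ‼-letter s k lt

‼-++ : ∀ {A : Set} (xs ys : List A) k → (xs ++ ys) ‼ (length xs + k) ≡ ys ‼ k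
‼-++ []       ys k = refl
‼-++ (x ∷ xs) ys k = ‼-++ xs ys k

OccursAt : ℕ → Str → Str → Set
OccursAt b s s′ = b + length s ≤ length s′ × (∀ k → k < length s → letter s k ≡ letter s′ (b + k))

substring⇒OccursAt : ∀ {s s′} → s IsSubstringOf s′ → ∃[ b ] OccursAt b s s′
substring⇒OccursAt (here prefix) = 0 , occurs prefix
  where
  occurs : ∀ {s s′} → Prefix _≡_ s s′ → OccursAt 0 s s′
  occurs Prefix.[]            = z≤n , λ _ ()
  occurs (refl Prefix.∷ rest) with occurs rest
  ... | le , eq = s≤s le , λ { zero _ → refl ; (suc k) (s≤s lt) → eq k lt }
substring⇒OccursAt (there infix′) with substring⇒OccursAt infix′
... | b , le , eq = suc b , s≤s le , eq

OccursAt⇒substring : ∀ b s s′ → OccursAt b s s′ → s IsSubstringOf s′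
OccursAt⇒substring zero s s′ (le , eq) = here (prefix s s′ le eq)
  where
  prefix : ∀ s s′ → length s ≤ length s′ → (∀ k → k < length s → letter s k ≡ letter s′ k) → Prefix _≡_ s s′
  prefix []      s′       le       eq = Prefix.[]
  prefix (a ∷ s) (b ∷ s′) (s≤s le) eq = eq 0 (s≤s z≤n) Prefix.∷ prefix s s′ le (λ k lt → eq (suc k) (s≤s lt))
OccursAt⇒substring (suc b) s (a ∷ s′) (s≤s le , eq) = there (OccursAt⇒substring b s s′ (le , eq))

module _ {A : Set} {P Q : Pred A 0ℓ} (P? : Decidable P) (Q? : Decidable Q) (P⊆Q : P ⊆ Q) where

  length-filter-mono : ∀ xs → length (filter P? xs) ≤ length (filter Q? xs)
  length-filter-mono [] = z≤n
  length-filter-mono (x ∷ xs) with P? x | Q? x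
  ... | yes _ | yes _ = s≤s (length-filter-mono xs)
  ... | yes px | no ¬qx = ⊥-elim (¬qx (P⊆Q px))
  ... | no _  | yes _ = m≤n⇒m≤1+n (length-filter-mono xs)
  ... | no _  | no _  = length-filter-mono xs

module _ (docs : Docs) where

  private
    text : Str
    text = concat docs

    n : ℕ
    n = totalLength docs

  length-substringAt : ∀ {b ℓ} → b + ℓ ≤ n → length (substringAt docs (b , ℓ)) ≡ ℓ
  length-substringAt {b} {ℓ} le = trans (length-take ℓ (drop b text)) (trans (cong (ℓ ⊓_) (length-drop b text))
    (m≤n⇒m⊓n≡m (m+n≤o⇒m≤o∸n ℓ (subst (_≤ n) (+-comm b ℓ) le))))

  letter-substringAt : ∀ b ℓ k → k < ℓ → letter (substringAt docs (b , ℓ)) k ≡ letter text (b + k)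
  letter-substringAt b ℓ k lt = trans (letter-take ℓ (drop b text) k lt) (letter-drop b text k)

  OccursInAtLeast-mono : ∀ d {s s′} → s′ IsSubstringOf s → OccursInAtLeast d docs s → OccursInAtLeast d docs s′
  OccursInAtLeast-mono d {s} {s′} s′⊑s d≤ = ≤-trans d≤
    (length-filter-mono (s isSubstringOf?_) (s′ isSubstringOf?_) (Infix.trans trans s′⊑s) docs)

Occurs⇒substring-concat : ∀ docs s → 1 ≤ length (filter (s isSubstringOf?_) docs) → s IsSubstringOf concat docs
Occurs⇒substring-concat (doc ∷ docs) s 1≤ with s isSubstringOf? doc
... | yes s⊑doc = s⊑doc ⁱ++ concat docs
... | no _      = doc ++ⁱ Occurs⇒substring-concat docs s 1≤

module _ (docs done : Docs) (doc : Str) (rest : Docs) (split : docs ≡ done ++ doc ∷ rest) where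

  private
    Y = totalLength done

  letter-concat : ∀ k → k < length doc → letter (concat docs) (Y + k) ≡ letter doc k
  letter-concat k lt = trans (cong (λ s → letter s (Y + k)) (trans (cong concat split) (sym (concat-++ done (doc ∷ rest)))))
    (trans (letter-++ʳ (concat done) (doc ++ concat rest) k) (letter-++ˡ doc (concat rest) k lt))

  module _ (X K : ℕ) (X+K≤n : X + K ≤ totalLength docs) where

    private
      s = substringAt docs (X , K)

      length-s : length s ≡ K
      length-s = length-substringAt docs X+K≤n

    match⇒substring : ∀ q → Y ≤ q → q + K ≤ Y + length doc →
      (∀ k → k < K → letter (concat docs) (X + k) ≡ letter (concat docs) (q + k)) → s IsSubstringOf doc
    match⇒substring q Y≤q q+K≤ match = OccursAt⇒substring (q ∸ Y) s doc
      ( subst (λ ℓ → q ∸ Y + ℓ ≤ length doc) (sym length-s) (fits K ≤-refl)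
      , λ k lt → let k<K = subst (k <_) length-s lt in
          trans (letter-substringAt docs X K k k<K) (trans (match k k<K)
            (trans (cong (letter (concat docs)) (sym (position k))) (letter-concat (q ∸ Y + k)
              (<-≤-trans (+-monoʳ-< (q ∸ Y) k<K) (fits K ≤-refl))))))
      where
      position : ∀ k → Y + (q ∸ Y + k) ≡ q + k
      position k = trans (sym (+-assoc Y (q ∸ Y) k)) (cong (_+ k) (m+[n∸m]≡n Y≤q))

      fits : ∀ k → k ≤ K → q ∸ Y + k ≤ length doc
      fits k k≤K = +-cancelˡ-≤ Y _ _ (subst (_≤ Y + length doc) (sym (position k)) (≤-trans (+-monoʳ-≤ q k≤K) q+K≤))

    substring⇒match : s IsSubstringOf doc → ∃[ q ] Y ≤ q × q + K ≤ Y + length doc ×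
      (∀ k → k < K → letter (concat docs) (X + k) ≡ letter (concat docs) (q + k))
    substring⇒match s⊑doc with substring⇒OccursAt s⊑doc
    ... | b , le , eq = Y + b , m≤m+n Y b , subst (_≤ Y + length doc) (sym (+-assoc Y b K)) (+-monoʳ-≤ Y le′) ,
          λ k k<K → trans (sym (letter-substringAt docs X K k k<K))
            (trans (eq k (subst (k <_) (sym length-s) k<K))
              (trans (sym (letter-concat (b + k) (<-≤-trans (+-monoʳ-< b k<K) le′)))
                (cong (letter (concat docs)) (sym (+-assoc Y b k)))))
      where
      le′ : b + K ≤ length doc
      le′ = subst (λ ℓ → b + ℓ ≤ length doc) length-s le

window-substring : ∀ docs {s p q ℓ} → OccursAt p s (concat docs) → p ≤ q → q + ℓ ≤ p + length s →
  substringAt docs (q , ℓ) IsSubstringOf s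
window-substring docs {s} {p} {q} {ℓ} (le , eq) p≤q q+ℓ≤ = OccursAt⇒substring (q ∸ p) _ s
  ( subst (λ k → q ∸ p + k ≤ length s) (sym length-w) inside
  , λ k lt → let k<ℓ = subst (k <_) length-w lt in
      trans (letter-substringAt docs q ℓ k k<ℓ)
        (trans (cong (letter (concat docs)) (sym (position k)))
          (sym (eq (q ∸ p + k) (<-≤-trans (+-monoʳ-< (q ∸ p) k<ℓ) inside)))))
  where
  position : ∀ k → p + (q ∸ p + k) ≡ q + k
  position k = trans (sym (+-assoc p (q ∸ p) k)) (cong (_+ k) (m+[n∸m]≡n p≤q))

  inside : q ∸ p + ℓ ≤ length s
  inside = +-cancelˡ-≤ p _ _ (subst (_≤ p + length s) (sym (position ℓ)) q+ℓ≤)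

  length-w : length (substringAt docs (q , ℓ)) ≡ ℓ
  length-w = length-substringAt docs (≤-trans q+ℓ≤ le)

OccursAt-substringAt : ∀ docs {b ℓ} → b + ℓ ≤ totalLength docs → OccursAt b (substringAt docs (b , ℓ)) (concat docs)
OccursAt-substringAt docs {b} {ℓ} le =
  subst (λ k → b + k ≤ totalLength docs) (sym length-s) le ,
  λ k lt → letter-substringAt docs b ℓ k (subst (k <_) length-s lt)
  where
  length-s : length (substringAt docs (b , ℓ)) ≡ ℓ
  length-s = length-substringAt docs le

-- Matching a window against a document

-- The window is T[X..X + K), the current document T[Y..Z), and E = Z - K the last position where the window fits.
-- The best output so far is (best , ℓ), and n = X + ℓ + rest.  All positions are relative to the start of the text,
-- which is stored at address base of the input: 2 ^ w may equal base + n, so base + Z could overflow.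
record Frame : Set where
  constructor frame
  field
    n base d h rest X ℓ best K a Y cnt len Z E : ℕ

record Scratch : Set where
  constructor scratch
  field
    r u v c e : ℕ

mem : Frame → (y i p j : ℕ) → Scratch → List Word
mem (frame n base d h rest X ℓ best K a Y cnt len Z E) y i p j (scratch r u v c e) =
  n ∷ base ∷ d ∷ h ∷ 1 ∷ rest ∷ X ∷ ℓ ∷ best ∷ K ∷ a ∷ Y ∷ cnt ∷ len ∷ Z ∷ E ∷
  y ∷ i ∷ p ∷ j ∷ r ∷ u ∷ v ∷ c ∷ e ∷ []

module Fits (w : ℕ) {base n : ℕ} (fits : base + n ≤ 2 ^ w) (4≤base : 4 ≤ base) where

  below : ∀ {k} → k < base + n → k < 2 ^ w
  below lt′ = <-≤-trans lt′ fits

  small : ∀ {k} → k ≤ n → k < 2 ^ w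
  small k≤n = below (≤-<-trans k≤n (m<n+m n (≤-trans (s≤s z≤n) 4≤base)))

  fit : ∀ {k} → k ≤ n → truncate w k ≡ k
  fit k≤n = truncate-id w (small k≤n)

  fit-addr : ∀ {k} → k < n → truncate w (base + k) ≡ base + k
  fit-addr k<n = truncate-id w (below (+-monoʳ-< base k<n))

  fit-const : ∀ {k} → k < 4 → truncate w k ≡ k
  fit-const k<4 = truncate-id w (below (<-≤-trans k<4 (≤-trans 4≤base (m≤m+n base n))))

record Readable (w : ℕ) (input : List Word) (T : ℕ → ℕ) (f : Frame) : Set where
  open Frame f
  field
    fits   : base + n ≤ 2 ^ w
    4≤base : 4 ≤ base
    read-T : ∀ k → k < n → input ‼ (base + k) ≡ just (T k)
    X+K≤n  : X + K ≤ n
    E+K≤n  : E + K ≤ n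
    1≤K    : 1 ≤ K

module Matching (w : ℕ) (input : List Word) (T : ℕ → ℕ) (f : Frame) (readable : Readable w input T f) where
  open Frame f
  open Readable readable
  open Exec w program input
  open Fits w fits 4≤base
  open Scratch using (r)

  x : ℕ → ℕ
  x k = T (X + k)

  open Words x

  Match : ℕ → Set
  Match q = ∀ k → k < K → x k ≡ T (q + k)

  private
    at : Label → (y i p j : ℕ) → Scratch → State
    at L y i p j g = ⟨ L , mem f y i p j g ⟩

    K≤n : K ≤ n
    K≤n = m+n≤o⇒n≤o X X+K≤n

    X+k<n : ∀ {k} → k < K → X + k < n
    X+k<n k<K = <-≤-trans (+-monoʳ-< X k<K) X+K≤n

    y+k<n : ∀ {y k} → y ≤ E → k < K → y + k < n
    y+k<n y≤E k<K = <-≤-trans (+-mono-≤-< y≤E k<K) E+K≤n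

  run-reset : ∀ {y i p j} g → at resetL y i p j g ⟶[ 3 ] at searchL y 0 0 0 g
  run-reset g = run 3 (0 , fit z≤n , 0 , fit z≤n , 0 , fit z≤n , refl)

  module _ {y i p j : ℕ} where

    module _ (y≤E : y ≤ E) (j<K : j < K) where
      private
        j≤n : j ≤ n
        j≤n = ≤-trans (<⇒≤ j<K) K≤n

        compared : Scratch → Scratch
        compared g = scratch (r g) (base + (X + j)) (base + (y + j)) (x j) (T (y + j))

      run-letters : ∀ g → at searchL y i p j g ⟶[ 8 ] at compareL y i p j (compared g)
      run-letters g = run 8
        (inj₂ (y≤E , inj₂ (<⇒≢ j<K ,
          X + j , fit (<⇒≤ (X+k<n j<K)) , base + (X + j) , fit-addr (X+k<n j<K) , x j , read-T _ (X+k<n j<K) ,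
          y + j , fit (<⇒≤ (y+k<n y≤E j<K)) , base + (y + j) , fit-addr (y+k<n y≤E j<K) ,
          T (y + j) , read-T _ (y+k<n y≤E j<K) , refl)))

      run-match : ∀ g → x j ≡ T (y + j) → at searchL y i p j g ⟶[ 9 ] at sameL y i p j (compared g)
      run-match g eq = run-letters g ◅◅ run 1 (inj₁ (eq , refl))

      module _ (g : Scratch) (x≢T : x j ≢ T (y + j)) where

        run-mismatch-≤ : p ≤ i → at searchL y i p j g ⟶[ 10 ] at aperiodicL y i p j (compared g)
        run-mismatch-≤ p≤i = run-letters g ◅◅ run 2 (inj₂ (x≢T , inj₂ (p≤i , refl)))

        run-mismatch-< : i < p → at searchL y i p j g ⟶[ 10 ] at testL y i p j (compared g)
        run-mismatch-< i<p = run-letters g ◅◅ run 2 (inj₂ (x≢T , inj₁ (i<p , refl)))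

      run-aperiodic : ∀ g → y + suc (j / 3) ≤ n →
        ∃[ g′ ] at aperiodicL y i p j g ⟶[ 8 ] at searchL (y + (j / 3 + 1)) 0 0 0 g′
      run-aperiodic g fits′ = _ , (run 5
        ( 3 , fit-const ≤-refl , j / 3 , div-id w (small j≤n)
        , j / 3 + 1 , fit (≤-trans (m≤n+m (j / 3 + 1) y) fits″) , y + (j / 3 + 1) , fit fits″ , refl) ◅◅ run-reset _)
        where
        fits″ : y + (j / 3 + 1) ≤ n
        fits″ = subst (λ z → y + z ≤ n) (+-comm 1 (j / 3)) fits′

      module _ (i+p≤j : i + p ≤ j) where
        private
          s+p<j : ∀ {s} → s < i → s + p < j
          s+p<j s<i = <-≤-trans (+-monoˡ-< p s<i) i+p≤j

        module _ (g : Scratch) (r<i : r g < i) where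
          private
            r<K : r g < K
            r<K = <-trans (≤-<-trans (m≤m+n (r g) p) (s+p<j r<i)) j<K
            r+p<K : r g + p < K
            r+p<K = <-trans (s+p<j r<i) j<K

          tested : Scratch
          tested = scratch (r g) (base + (X + r g)) (base + (X + (r g + p))) (x (r g)) (x (r g + p))

          run-test-letters : at testLoopL y i p j g ⟶[ 8 ] at testCompareL y i p j tested
          run-test-letters = run 8 (inj₂ (<⇒≢ r<i ,
            X + r g , fit (<⇒≤ (X+k<n r<K)) , base + (X + r g) , fit-addr (X+k<n r<K) , x (r g) , read-T _ (X+k<n r<K) ,
            r g + p , fit (≤-trans (<⇒≤ r+p<K) K≤n) , X + (r g + p) , fit (<⇒≤ (X+k<n r+p<K)) ,
            base + (X + (r g + p)) , fit-addr (X+k<n r+p<K) , x (r g + p) , read-T _ (X+k<n r+p<K) , refl))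

          run-test-next : x (r g) ≡ x (r g + p) →
            at testLoopL y i p j g ⟶[ 11 ] at testLoopL y i p j (record tested { r = r g + 1 })
          run-test-next eq = run-test-letters ◅◅ run 3 (inj₁ (eq , r g + 1 ,
            fit (≤-trans (≤-reflexive (+-comm (r g) 1)) (≤-trans r<K K≤n)) , refl))

        Tested : Scratch → ℕ → Scratch → Set
        Tested g t g′ =
          ((∀ s → r g ≤ s → s < i → x s ≡ x (s + p)) × at testLoopL y i p j g ⟶[ t ] at periodicL y i p j g′) ⊎
          ((∃[ s ] s < i × x s ≢ x (s + p)) × at testLoopL y i p j g ⟶[ t ] at aperiodicL y i p j g′)

        run-test-loop : ∀ k g → r g + k ≡ i → ∃[ t ] ∃[ g′ ] t ≤ 11 * k + 10 × Tested g t g′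
        run-test-loop zero g eq = 1 , g , s≤s z≤n ,
          inj₁ ((λ s r≤s s<i → ⊥-elim (<⇒≱ s<i (subst (_≤ s) r≡i r≤s))) , run 1 (inj₁ (r≡i , refl)))
          where
          r≡i : r g ≡ i
          r≡i = trans (sym (+-identityʳ (r g))) eq
        run-test-loop (suc k) g eq = continue (x (r g) ≟ x (r g + p))
          where
          r<i : r g < i
          r<i = subst (r g <_) eq (m<m+n (r g) (s≤s z≤n))
          continue : Dec (x (r g) ≡ x (r g + p)) → ∃[ t ] ∃[ g′ ] t ≤ 11 * suc k + 10 × Tested g t g′
          continue (no x≢x) = 10 , tested g r<i , m≤n+m 10 (11 * suc k) ,
            inj₂ ((r g , r<i , x≢x) , run-test-letters g r<i ◅◅ run 2 (inj₂ (x≢x , refl)))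
          continue (yes x≡x) with run-test-loop k (record (tested g r<i) { r = r g + 1 }) (trans (+-assoc (r g) 1 k) eq)
          ... | t , g′ , t≤ , outcome = 11 + t , g′ , bound , extended outcome
            where
            bound : 11 + t ≤ 11 * suc k + 10
            bound = ≤-trans (+-monoʳ-≤ 11 t≤) (≤-reflexive (trans (sym (+-assoc 11 (11 * k) 10)) (cong (_+ 10) (sym (*-suc 11 k)))))
            extended : Tested (record (tested g r<i) { r = r g + 1 }) t g′ → Tested g (11 + t) g′
            extended (inj₂ (witness , path)) = inj₂ (witness , run-test-next g r<i x≡x ◅◅ path)
            extended (inj₁ (agree , path)) = inj₁ (agree′ , run-test-next g r<i x≡x ◅◅ path)
              where
              agree′ : ∀ s → r g ≤ s → s < i → x s ≡ x (s + p)
              agree′ s r≤s s<i with m≤n⇒m<n∨m≡n r≤s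
              ... | inj₁ r<s = agree s (≤-trans (≤-reflexive (+-comm (r g) 1)) r<s) s<i
              ... | inj₂ refl = x≡x

        run-test : ∀ g → ∃[ t ] ∃[ g′ ] t ≤ 11 + 11 * i ×
          ((∀ s → s < i → x s ≡ x (s + p)) × at testL y i p j g ⟶[ t ] at periodicL y i p j g′ ⊎
           (∃[ s ] s < i × x s ≢ x (s + p)) × at testL y i p j g ⟶[ t ] at aperiodicL y i p j g′)
        run-test g with run-test-loop i (record g { r = 0 }) refl
        ... | t , g′ , t≤ , outcome = 1 + t , g′ , s≤s (≤-trans t≤ (≤-reflexive (+-comm (11 * i) 10))) , extended outcome
          where
          start : at testL y i p j g ⟶[ 1 ] at testLoopL y i p j (record g { r = 0 })
          start = run 1 (0 , fit z≤n , refl)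
          extended : Tested (record g { r = 0 }) t g′ → _
          extended (inj₁ (agree , path)) = inj₁ ((λ s → agree s z≤n) , start ◅◅ path)
          extended (inj₂ (witness , path)) = inj₂ (witness , start ◅◅ path)

        module _ (y+p≤n : y + p ≤ n) where

          run-periodic-keep : ∀ g → i + p ≤ j ∸ p →
            ∃[ g′ ] at periodicL y i p j g ⟶[ 5 ] at searchL (y + p) i p (j ∸ p) g′
          run-periodic-keep g le = _ , run 5
            ( y + p , fit y+p≤n , j ∸ p , sub-id w (small j≤n) (m+n≤o⇒n≤o i i+p≤j)
            , i + p , fit (≤-trans i+p≤j j≤n) , inj₂ (le , refl))

          run-periodic-drop : ∀ g → j ∸ p < i + p →
            ∃[ g′ ] at periodicL y i p j g ⟶[ 7 ] at searchL (y + p) 0 0 0 g′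
          run-periodic-drop g lt′ = _ , (run 4
            ( y + p , fit y+p≤n , j ∸ p , sub-id w (small j≤n) (m+n≤o⇒n≤o i i+p≤j)
            , i + p , fit (≤-trans i+p≤j j≤n) , inj₁ (lt′ , refl)) ◅◅ run-reset _)

        private
          p≤j : p ≤ j
          p≤j = m+n≤o⇒n≤o i i+p≤j
          j+1≤n : j + 1 ≤ n
          j+1≤n = ≤-trans (≤-reflexive (+-comm j 1)) (≤-trans j<K K≤n)
          i≤j : i ≤ j
          i≤j = m+n≤o⇒m≤o i i+p≤j

          run-new : ∀ g → at newL y i p j g ⟶[ 3 ] at searchL y i (j + 1 ∸ i) (j + 1) g
          run-new g = run 3 (j + 1 , fit j+1≤n , j + 1 ∸ i , sub-id w (small j+1≤n) (≤-trans i≤j (m≤m+n j 1)) , refl)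

        run-empty : ∀ g → i ≡ j → at sameL y i p j g ⟶[ 4 ] at searchL y i (j + 1 ∸ i) (j + 1) g
        run-empty g i≡j = run 1 (inj₁ (i≡j , refl)) ◅◅ run-new g

        -- `c` still holds `x j` from the successful comparison, so only `x (j ∸ p)` has to be
        -- fetched.
        module _ (g : Scratch) (c≡ : Scratch.c g ≡ x j) (i≢j : i ≢ j) (1≤p : 1 ≤ p) where
          private
            instance
              p≢0 : NonZero p
              p≢0 = >-nonZero 1≤p

            j-p<K : j ∸ p < K
            j-p<K = ≤-<-trans (m∸n≤m j p) j<K

            previous : Scratch
            previous = record g { u = base + (X + (j ∸ p)) ; e = x (j ∸ p) }

            fetch : ∀ {k L g′} →
              at (5 + sameL) y i p j previous ⟶[ k ] at L y i p j g′ → at sameL y i p j g ⟶[ 5 + k ] at L y i p j g′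
            fetch path = run 5 (inj₂ (i≢j , j ∸ p , sub-id w (small j≤n) p≤j ,
              X + (j ∸ p) , fit (<⇒≤ (X+k<n j-p<K)) , base + (X + (j ∸ p)) , fit-addr (X+k<n j-p<K) ,
              x (j ∸ p) , read-T _ (X+k<n j-p<K) , refl)) ◅◅ path

          run-extend : x j ≡ x (j ∸ p) → ∃[ g′ ] at sameL y i p j g ⟶[ 8 ] at searchL y i p (j + 1) g′
          run-extend eq = _ , (fetch (run 1 (inj₁ (trans c≡ eq , refl))) ◅◅ run 2 (j + 1 , fit j+1≤n , refl))

          run-less : x j < x (j ∸ p) → ∃[ g′ ] at sameL y i p j g ⟶[ 10 ] at searchL y i (j + 1 ∸ i) (j + 1) g′
          run-less x<x = _ , (fetch (run 2 (inj₂ (<⇒≢ c< , inj₁ (c< , refl)))) ◅◅ run-new _)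
            where
            c< : Scratch.c g < x (j ∸ p)
            c< = subst (_< x (j ∸ p)) (sym c≡) x<x

          run-greater : x (j ∸ p) < x j → ∃[ g′ ]
            at sameL y i p j g ⟶[ 13 ] at searchL y (j ∸ (j ∸ i) % p) 0 (j ∸ (j ∸ i) % p + 0) g′
          run-greater x>x = _ , (fetch (run 2 (inj₂ ((λ eq → <⇒≢ c> (sym eq)) , inj₂ (<⇒≤ c> , refl)))) ◅◅ run 6
            ( j ∸ i , sub-id w (small j≤n) i≤j , (j ∸ i) % p , mod-id w (small (≤-trans (m∸n≤m j i) j≤n))
            , j ∸ (j ∸ i) % p , sub-id w (small j≤n) (≤-trans (m%n≤m (j ∸ i) p) (m∸n≤m j i))
            , 0 , fit z≤n , j ∸ (j ∸ i) % p + 0 , fit (≤-trans (≤-reflexive (+-identityʳ _)) (≤-trans (m∸n≤m j ((j ∸ i) % p)) j≤n)) , refl))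
            where
            c> : x (j ∸ p) < Scratch.c g
            c> = subst (x (j ∸ p) <_) (sym c≡) x>x

  -- `known` is not stored by the program: it counts the letters known to match at `y`, which may be
  -- more than `j` after `j` was set back, and serves as the `J` of `Factored`. The bound on `y` is
  -- `E + K` because the last shift may overshoot `E`.
  record Inv (y i p j : ℕ) : Set where
    field
      known    : ℕ
      factored : Factored known i p j
      matched  : ∀ k → k < known → x k ≡ T (y + k)
      j≤K      : j ≤ K
      y≤E+K    : y ≤ E + K
      Y≤y      : Y ≤ y
      excluded : ∀ q → Y ≤ q → q < y → ¬ Match q
    open Factored factored public

  -- A potential which each iteration increases by at least the number of its instructions.
  Φ : ℕ → ℕ → ℕ → ℕ
  Φ y i j = 200 * y + 22 * (i + j)

  Φmax : ℕ
  Φmax = 200 * (E + K) + 22 * (K + K)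

  Next : (y i p j : ℕ) → Scratch → Set
  Next y i p j g = ∃[ y′ ] ∃[ i′ ] ∃[ p′ ] ∃[ j′ ] ∃[ g′ ] ∃[ t ]
    Inv y′ i′ p′ j′ × suc t + Φ y i j ≤ Φ y′ i′ j′ × at searchL y i p j g ⟶[ suc t ] at searchL y′ i′ p′ j′ g′

  module _ {y i p j : ℕ} (g : Scratch) (inv : Inv y i p j) (y≤E : y ≤ E) (j<K : j < K) where
    open Inv inv

    private
      j+1≤K : j + 1 ≤ K
      j+1≤K = ≤-trans (≤-reflexive (+-comm j 1)) j<K

      inv′ : ∀ {J′ p′} → Factored J′ i p′ (suc j) → (∀ k → k < J′ → x k ≡ T (y + k)) → Inv y i p′ (j + 1)
      inv′ {J′} {p′} F m = record
        { known = J′ ; factored = subst (Factored J′ i p′) (+-comm 1 j) F ; matched = m ; j≤K = j+1≤K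
        ; y≤E+K = y≤E+K ; Y≤y = Y≤y ; excluded = excluded }

      new-period : suc j ∸ i ≡ j + 1 ∸ i
      new-period = cong (_∸ i) (+-comm 1 j)

    next-known : x j ≡ T (y + j) → ∀ J′ → Factored J′ i p j → (∀ k → k < J′ → x k ≡ T (y + k)) → j < J′ → Next y i p j g
    next-known x≡T J′ F m j<J′ with i ≟ j
    ... | yes i≡j = y , i , j + 1 ∸ i , j + 1 , _ , 12 ,
          inv′ (subst (λ q → Factored J′ i q (suc j)) new-period (Factored-empty F j<J′ i≡j)) m ,
          cost-step y i j 13 (m≤m+n 13 9) , (run-match y≤E j<K g x≡T ◅◅ run-empty y≤E j<K i+p≤j _ i≡j)
    ... | no i≢j with <-cmp (x j) (x (j ∸ p))
    ...   | tri≈ _ x≡x _ with run-extend y≤E j<K i+p≤j _ refl i≢j (i≢j⇒p>0 i≢j) x≡x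
    ...     | g′ , path = y , i , p , j + 1 , g′ , 16 , inv′ (Factored-equal F j<J′ i≢j x≡x) m ,
              cost-step y i j 17 (m≤m+n 17 5) , (run-match y≤E j<K g x≡T ◅◅ path)
    next-known x≡T J′ F m j<J′ | no i≢j | tri< x<x _ _ with run-less y≤E j<K i+p≤j _ refl i≢j (i≢j⇒p>0 i≢j) x<x
    ...     | g′ , path = y , i , j + 1 ∸ i , j + 1 , g′ , 18 ,
              inv′ (subst (λ q → Factored J′ i q (suc j)) new-period (Factored-less F j<J′ i≢j x<x)) m ,
              cost-step y i j 19 (m≤m+n 19 3) , (run-match y≤E j<K g x≡T ◅◅ path)
    next-known x≡T J′ F m j<J′ | no i≢j | tri> _ _ x>x with run-greater y≤E j<K i+p≤j _ refl i≢j (i≢j⇒p>0 i≢j) x>x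
    ...     | g′ , path = y , j ∸ k , 0 , j ∸ k + 0 , g′ , 21 ,
              record
                { known = J′
                ; factored = subst (Factored J′ (j ∸ k) 0) (sym (+-identityʳ (j ∸ k))) (Factored-greater F j<J′ i≢j k refl x>x)
                ; matched = m
                ; j≤K = ≤-trans (≤-reflexive (+-identityʳ (j ∸ k))) (≤-trans (m∸n≤m j k) (<⇒≤ j<K))
                ; y≤E+K = y≤E+K ; Y≤y = Y≤y ; excluded = excluded } ,
              cost-rewind y i p j (j ∸ k) k rewind (m%n<n (j ∸ i) p) (m∸n+n≡m (≤-trans (m%n≤m (j ∸ i) p) (m∸n≤m j i))) ,
              (run-match y≤E j<K g x≡T ◅◅ path)
      where
      instance
        p≢0 : NonZero p
        p≢0 = >-nonZero (i≢j⇒p>0 i≢j)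
      k : ℕ
      k = (j ∸ i) % p
      rewind : i + p ≤ j ∸ k
      rewind = m+n≤o⇒m≤o∸n (i + p) (≤-trans (≤-reflexive (+-assoc i p k))
        (≤-trans (+-monoʳ-≤ i p+k≤) (≤-reflexive (m+[n∸m]≡n i≤j))))
        where
        p+k≤ : p + k ≤ j ∸ i
        p+k≤ = ≤-trans (+-monoˡ-≤ k (≤-trans (≤-reflexive (sym (*-identityˡ p)))
            (*-monoˡ-≤ p (m≥n⇒m/n>0 (m+n≤o⇒m≤o∸n p (≤-trans (≤-reflexive (+-comm p i)) i+p≤j))))))
          (≤-reflexive (trans (+-comm ((j ∸ i) / p * p) k) (sym (m≡m%n+[m/n]*n (j ∸ i) p))))

    -- Below `known` the comparison only repeats an earlier one; at `known` it supplies a new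
    -- letter.
    next-match : x j ≡ T (y + j) → Next y i p j g
    next-match x≡T with m≤n⇒m<n∨m≡n j≤J
    ... | inj₁ j<J = next-known x≡T known factored matched j<J
    ... | inj₂ refl = next-known x≡T (suc known) (Factored-mono (n≤1+n known) factored) matched′ ≤-refl
      where
      matched′ : ∀ k → k < suc known → x k ≡ T (y + k)
      matched′ k (s≤s k≤) with m≤n⇒m<n∨m≡n k≤
      ... | inj₁ k< = matched k k<
      ... | inj₂ refl = x≡T

    module _ (x≢T : x j ≢ T (y + j)) where
      private
        -- A mismatch at `j` refutes `j < known`. So at this moment all witnesses of maximality lie
        -- in x[0..j), as the lemmas on periods require.
        known≤j : known ≤ j
        known≤j with known ≤? j
        ... | yes k≤j = k≤j
        ... | no k≰j = ⊥-elim (x≢T (matched j (≰⇒> k≰j)))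

        complete : Factored j i p j
        complete = Factored-mono known≤j factored

        matched-j : ∀ k → k < j → x k ≡ T (y + k)
        matched-j k k<j = matched k (<-≤-trans k<j j≤J)

        -- The prefix matched at `y` overlaps the supposed match at `y + q`. Hence every lower bound
        -- on the periods of the matched prefix is a safe shift.
        Match-shift⇒Period : ∀ q → Match (y + q) → Period q j
        Match-shift⇒Period q match k k+q<j =
          trans (match k (≤-<-trans (m≤m+n k q) (<-trans k+q<j j<K)))
            (trans (cong T (trans (+-assoc y q k) (cong (y +_) (+-comm q k)))) (sym (matched-j (k + q) k+q<j)))

        excluded′ : ∀ s → (∀ q → 1 ≤ q → Period q j → s ≤ q) → ∀ q → Y ≤ q → q < y + s → ¬ Match q
        excluded′ s safe q Y≤q q<y+s match with <-cmp q y
        ... | tri< q<y _ _ = excluded q Y≤q q<y match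
        ... | tri≈ _ refl _ = x≢T (match j j<K)
        ... | tri> _ _ y<q = <⇒≱ q<y+s (subst (y + s ≤_) y+q′ (+-monoʳ-≤ y
                (safe (q ∸ y) (m<n⇒0<n∸m y<q) (Match-shift⇒Period (q ∸ y) (subst Match (sym y+q′) match)))))
          where
          y+q′ : y + (q ∸ y) ≡ q
          y+q′ = m+[n∸m]≡n (<⇒≤ y<q)

        y+s≤ : ∀ {s} → s ≤ K → y + s ≤ E + K
        y+s≤ s≤K = +-mono-≤ y≤E s≤K

        restart : ∀ s → s ≤ K → (∀ q → 1 ≤ q → Period q j → s ≤ q) → Inv (y + s) 0 0 0
        restart s s≤K safe = record
          { known = 0 ; factored = Factored-start ; matched = λ _ () ; j≤K = z≤n
          ; y≤E+K = y+s≤ s≤K ; Y≤y = ≤-trans Y≤y (m≤m+n y s) ; excluded = excluded′ s safe }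

        j/3<K : suc (j / 3) ≤ K
        j/3<K = ≤-trans (s≤s (m/n≤m j 3)) j<K

        j<3* : j < suc (j / 3) * 3
        j<3* = subst (_< suc (j / 3) * 3) (sym (m≡m%n+[m/n]*n j 3)) (+-monoˡ-< (j / 3 * 3) (m%n<n j 3))

        p≤K : p ≤ K
        p≤K = ≤-trans (m+n≤o⇒n≤o i i+p≤j) (<⇒≤ j<K)

      next-aperiodic : ∀ g′ t → t ≤ 20 + 11 * i → (1 ≤ p → ¬ Period p j) →
        at searchL y i p j g ⟶[ suc t ] at aperiodicL y i p j g′ → Next y i p j g
      next-aperiodic g′ t t≤ ¬per path with run-aperiodic {i = i} {p = p} y≤E j<K g′ (≤-trans (y+s≤ j/3<K) E+K≤n)
      ... | g″ , path′ = y + (j / 3 + 1) , 0 , 0 , 0 , g″ , t + 8 ,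
            subst (λ s → Inv (y + s) 0 0 0) (+-comm 1 (j / 3)) (restart (suc (j / 3)) j/3<K (aperiodic complete ¬per)) ,
            cost-aperiodic y i j (j / 3 + 1) (suc (t + 8))
              (≤-trans (s≤s (+-monoˡ-≤ 8 t≤)) (≤-reflexive (cong suc (+-comm (20 + 11 * i) 8))))
              i≤j (subst (λ s → j < s * 3) (+-comm 1 (j / 3)) j<3*) ,
            (path ◅◅ path′)

      next-mismatch : Next y i p j g
      next-mismatch with i <? p
      ... | no i≮p = next-aperiodic _ 9 (m≤m+n 9 (11 + 11 * i))
              (λ 1≤p per → i≮p (i<period complete p 1≤p per)) (run-mismatch-≤ y≤E j<K g x≢T (≮⇒≥ i≮p))
      ... | yes i<p with run-test y≤E j<K i+p≤j _
      ...   | t , g′ , t≤ , inj₂ ((s , s<i , x≢x) , path) = next-aperiodic g′ (9 + t) (+-monoʳ-≤ 9 t≤)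
                (λ _ per → x≢x (per s (<-≤-trans (+-monoˡ-< p s<i) i+p≤j)))
                (run-mismatch-< y≤E j<K g x≢T i<p ◅◅ path)
      ...   | t , g′ , t≤ , inj₁ (agree , path) = next-periodic (i + p ≤? j ∸ p)
        where
        per : Period p j
        per s s+p<j with s <? i
        ... | yes s<i = agree s s<i
        ... | no s≮i = periodic s (≮⇒≥ s≮i) s+p<j

        p≤j : p ≤ j
        p≤j = m+n≤o⇒n≤o i i+p≤j

        cost : ∀ k → k ≤ 7 → suc (9 + t + k) ≤ 28 + 11 * i
        cost k k≤7 = s≤s (≤-trans (+-mono-≤ (+-monoʳ-≤ 9 t≤) k≤7) (≤-reflexive (+-comm (20 + 11 * i) 7)))

        y+p≤n : y + p ≤ n
        y+p≤n = ≤-trans (y+s≤ p≤K) E+K≤n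

        start : at searchL y i p j g ⟶[ 10 + t ] at periodicL y i p j g′
        start = run-mismatch-< y≤E j<K g x≢T i<p ◅◅ path

        next-periodic : Dec (i + p ≤ j ∸ p) → Next y i p j g
        next-periodic (yes le) with run-periodic-keep y≤E j<K i+p≤j y+p≤n g′ le
        ... | g″ , path′ = y + p , i , p , j ∸ p , g″ , 9 + t + 5 ,
              record
                { known = j ∸ p ; factored = Factored-shift complete per le (≤-<-trans z≤n i<p)
                ; matched = λ k k<j-p → trans (per k (subst (k + p <_) (m∸n+n≡m p≤j) (+-monoˡ-< p k<j-p)))
                    (trans (matched-j (k + p) (subst (k + p <_) (m∸n+n≡m p≤j) (+-monoˡ-< p k<j-p)))
                      (cong T (trans (cong (y +_) (+-comm k p)) (sym (+-assoc y p k)))))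
                ; j≤K = ≤-trans (m∸n≤m j p) (<⇒≤ j<K)
                ; y≤E+K = y+s≤ p≤K ; Y≤y = ≤-trans Y≤y (m≤m+n y p)
                ; excluded = excluded′ p (p≤period complete) } ,
              cost-keep y i p j (j ∸ p) (suc (9 + t + 5)) (cost 5 (m≤m+n 5 2)) i<p (m∸n+n≡m p≤j) ,
              (start ◅◅ path′)
        next-periodic (no ≰) with run-periodic-drop y≤E j<K i+p≤j y+p≤n g′ (≰⇒> ≰)
        ... | g″ , path′ = y + p , 0 , 0 , 0 , g″ , 9 + t + 7 ,
              restart p p≤K (p≤period complete) ,
              cost-drop y i p j (j ∸ p) (suc (9 + t + 7)) (cost 7 ≤-refl) i<p (m∸n+n≡m p≤j) (≰⇒> ≰) ,
              (start ◅◅ path′)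

    next : Next y i p j g
    next with x j ≟ T (y + j)
    ... | yes x≡T = next-match x≡T
    ... | no x≢T = next-mismatch x≢T

  Searched : State → ℕ → Set
  Searched s t = ∃[ y ] ∃[ i ] ∃[ p ] ∃[ j ] ∃[ g ]
    (((∃[ q ] Y ≤ q × q ≤ E × Match q) × s ⟶[ t ] at foundL y i p j g) ⊎
    ((∀ q → Y ≤ q → q ≤ E → ¬ Match q) × s ⟶[ t ] at nextL y i p j g))

  Searched-after : ∀ {s s′ k t} → s ⟶[ k ] s′ → Searched s′ t → Searched s (k + t)
  Searched-after path (y , i , p , j , g , inj₁ (q , path′)) = y , i , p , j , g , inj₁ (q , path ◅◅ path′)
  Searched-after path (y , i , p , j , g , inj₂ (q , path′)) = y , i , p , j , g , inj₂ (q , path ◅◅ path′)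

  -- Each iteration raises the potential, which never exceeds `Φmax`, so `suc Φmax` units of fuel
  -- cannot run out. The 2 extra instructions are the tests that leave the loop.
  search-from : ∀ fuel {y i p j} g → Inv y i p j → Φmax < fuel + Φ y i j →
    ∃[ t ] t + Φ y i j ≤ Φmax + 2 × Searched (at searchL y i p j g) t
  search-from fuel {y} {i} {p} {j} g inv enough = continue fuel enough
    where
    open Inv inv
    Φ≤ : Φ y i j ≤ Φmax
    Φ≤ = +-mono-≤ (*-monoʳ-≤ 200 y≤E+K) (*-monoʳ-≤ 22 (+-mono-≤ (≤-trans i≤j j≤K) j≤K))

    stop : ∀ t → t ≤ 2 → t + Φ y i j ≤ Φmax + 2
    stop t t≤2 = ≤-trans (≤-reflexive (+-comm t (Φ y i j))) (+-mono-≤ Φ≤ t≤2)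

    continue : ∀ fuel → Φmax < fuel + Φ y i j → ∃[ t ] t + Φ y i j ≤ Φmax + 2 × Searched (at searchL y i p j g) t
    continue zero enough = ⊥-elim (<⇒≱ enough Φ≤)
    continue (suc fuel) enough with y ≤? E
    ... | no y≰E = 1 , stop 1 (s≤s z≤n) , y , i , p , j , g ,
          inj₂ ((λ q Y≤q q≤E → excluded q Y≤q (≤-<-trans q≤E (≰⇒> y≰E))) , run 1 (inj₁ (≰⇒> y≰E , refl)))
    ... | yes y≤E with j ≟ K
    ...   | yes refl = 2 , stop 2 ≤-refl , y , i , p , j , g ,
            inj₁ ((y , Y≤y , y≤E , λ k k<K → matched k (<-≤-trans k<K j≤J)) , run 2 (inj₂ (y≤E , inj₁ (refl , refl))))
    ...   | no j≢K with next g inv y≤E (≤∧≢⇒< j≤K j≢K)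
    ...     | y′ , i′ , p′ , j′ , g′ , k , inv′ , cost , path with search-from fuel g′ inv′ enough′
      where
      enough′ : Φmax < fuel + Φ y′ i′ j′
      enough′ = <-≤-trans enough (≤-trans (≤-reflexive (sym (+-suc fuel (Φ y i j))))
        (+-monoʳ-≤ fuel (≤-trans (s≤s (m≤n+m (Φ y i j) k)) cost)))
    ...       | t , t≤ , searched = suc k + t ,
                ≤-trans (≤-reflexive (trans (cong (_+ Φ y i j) (+-comm (suc k) t)) (+-assoc t (suc k) (Φ y i j))))
                  (≤-trans (+-monoʳ-≤ t cost) t≤) ,
                Searched-after path searched

  search : ∀ g {i p j} → Y ≤ E + K → ∃[ t ] t + 200 * Y ≤ Φmax + 5 × Searched (at resetL Y i p j g) t
  search g Y≤E+K with search-from (suc Φmax) g start (s≤s (m≤m+n Φmax (Φ Y 0 0)))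
    where
    start : Inv Y 0 0 0
    start = record
      { known = 0 ; factored = Factored-start ; matched = λ _ () ; j≤K = z≤n ; y≤E+K = Y≤E+K ; Y≤y = ≤-refl
      ; excluded = λ q Y≤q q<Y → ⊥-elim (<⇒≱ q<Y Y≤q) }
  ... | t , t≤ , searched = 3 + t ,
        ≤-trans (+-monoʳ-≤ 3 (≤-trans (≤-reflexive (cong (t +_) (sym (+-identityʳ (200 * Y))))) t≤))
          (≤-reflexive (trans (+-comm 3 (Φmax + 2)) (+-assoc Φmax 2 3))) ,
        Searched-after (run-reset g) searched

-- The loops over the documents and over the samples

module Algorithm (docs : Docs) (d τ w : ℕ) (m≤n : length docs ≤ totalLength docs) (1≤τ : 1 ≤ τ) (τ≤n : τ ≤ totalLength docs)
  (addressable : length (encode docs d τ) ≤ 2 ^ w) where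

  n m base h : ℕ
  n = totalLength docs
  m = length docs
  base = m + 4
  h = (τ + 1) / 2

  input : List Word
  input = encode docs d τ

  T : ℕ → ℕ
  T = letter (concat docs)

  1≤n : 1 ≤ n
  1≤n = ≤-trans 1≤τ τ≤n

  fits : base + n ≤ 2 ^ w
  fits = subst (_≤ 2 ^ w) size addressable
    where
    size : length input ≡ base + n
    size = trans (cong (4 +_) (trans (length-++ (map length docs)) (cong (_+ n) (length-map length docs))))
      (cong (_+ n) (+-comm 4 m))

  4≤base : 4 ≤ base
  4≤base = m≤n+m 4 m

  base<base+n : base < base + n
  base<base+n = m<m+n base 1≤n

  open Exec w program input
  open Fits w fits 4≤base public

  fit-4 : truncate w 4 ≡ 4
  fit-4 = truncate-id w (below (≤-<-trans 4≤base base<base+n))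

  read-T : ∀ k → k < n → input ‼ (base + k) ≡ just (T k)
  read-T k k<n = trans (cong (input ‼_) (cong (_+ k) (+-comm m 4)))
    (trans (cong (λ l → (map length docs ++ concat docs) ‼ (l + k)) (sym (length-map length docs)))
      (trans (‼-++ (map length docs) (concat docs) k) (‼-letter (concat docs) k k<n)))

  read-length : ∀ done doc rest → docs ≡ done ++ doc ∷ rest → input ‼ (4 + length done) ≡ just (length doc)
  read-length done doc rest eq =
    trans (cong (λ ds → (map length ds ++ concat docs) ‼ length done) eq) (lookup done)
    where
    lookup : ∀ done → (map length (done ++ doc ∷ rest) ++ concat docs) ‼ length done ≡ just (length doc)
    lookup []       = refl
    lookup (_ ∷ ds) = lookup ds

  totalLength-++ : ∀ ds es → totalLength (ds ++ es) ≡ totalLength ds + totalLength es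
  totalLength-++ ds es = trans (cong length (sym (concat-++ ds es))) (length-++ (concat ds))

  record Loc : Set where
    constructor loc
    field
      len Z E y i p j : ℕ
      g : Scratch

  state : Label → (rest X ℓ best K a Y cnt : ℕ) → Loc → State
  state L rest X ℓ best K a Y cnt (loc len Z E y i p j g) =
    ⟨ L , mem (frame n base d h rest X ℓ best K a Y cnt len Z E) y i p j g ⟩

  module Check (rest X ℓ best K : ℕ) (X+K≤n : X + K ≤ n) (1≤K : 1 ≤ K) where

    at : Label → (a Y cnt : ℕ) → Loc → State
    at L = state L rest X ℓ best K

    s : Str
    s = substringAt docs (X , K)

    count : Docs → ℕ
    count ds = length (filter (s isSubstringOf?_) ds)

    count-++ : ∀ ds es → count (ds ++ es) ≡ count ds + count es
    count-++ ds es = trans (cong length (filter-++ (s isSubstringOf?_) ds es)) (length-++ (filter (s isSubstringOf?_) ds))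

    count≤ : ∀ ds → count ds ≤ length ds
    count≤ [] = z≤n
    count≤ (doc ∷ ds) with s isSubstringOf? doc
    ... | yes _ = s≤s (count≤ ds)
    ... | no _ = m≤n⇒m≤1+n (count≤ ds)

    module Document (done : Docs) (doc : Str) (rest′ : Docs) (split : docs ≡ done ++ doc ∷ rest′) where

      Y len Z a : ℕ
      Y = totalLength done
      len = length doc
      Z = Y + len
      a = 4 + length done

      Z≤n : Z ≤ n
      Z≤n = subst (Z ≤_) (sym (trans (cong totalLength split) (trans (totalLength-++ done (doc ∷ rest′))
        (cong (Y +_) (length-++ doc))))) (+-monoʳ-≤ Y (m≤m+n len (totalLength rest′)))

      done<m : length done < m
      done<m = subst (length done <_) (sym (trans (cong length split) (length-++ done)))
        (m<m+n (length done) (s≤s z≤n))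

      a<base : a < base
      a<base = subst (a <_) (+-comm 4 m) (+-monoʳ-< 4 done<m)

      count-accept : s IsSubstringOf doc → count (done ++ [ doc ]) ≡ count done + 1
      count-accept s⊑doc = trans (count-++ done [ doc ])
        (cong (count done +_) (cong length (filter-accept (s isSubstringOf?_) s⊑doc)))

      count-reject : ¬ s IsSubstringOf doc → count (done ++ [ doc ]) ≡ count done
      count-reject s⋢doc = trans (count-++ done [ doc ]) (trans
        (cong (count done +_) (cong length (filter-reject (s isSubstringOf?_) s⋢doc))) (+-identityʳ (count done)))

      run-next : ∀ {Y cnt E y i p j} g → ∃[ g′ ]
        at nextL a Y cnt (loc len Z E y i p j g) ⟶[ 4 ] at docL (a + 1) (Z + 0) cnt (loc len Z E y i p j g′)
      run-next g = _ , run 4 (0 , fit z≤n , Z + 0 , fit (≤-trans (≤-reflexive (+-identityʳ Z)) Z≤n) ,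
        a + 1 , truncate-id w (below (≤-<-trans (≤-trans (≤-reflexive (+-comm a 1)) a<base) base<base+n)) , refl)

      Processed : (Y cnt : ℕ) → Loc → Set
      Processed Y cnt l = ∃[ t ] ∃[ l′ ] t ≤ 244 * len + 16 ×
        at docL a Y cnt l ⟶[ t ] at docL (a + 1) (Z + 0) (count (done ++ [ doc ])) l′

      run-short : len < K → ∀ l → Processed Y (count done) l
      run-short len<K (loc _ _ E y i p j g) with run-next {Y} {count done} {E} {y} {i} {p} {j} g
      ... | g′ , path = 8 , _ , ≤-trans (m≤m+n 8 8) (m≤n+m 16 (244 * len)) ,
            subst (λ c → _ ⟶[ 8 ] at docL (a + 1) (Z + 0) c (loc len Z E y i p j g′)) (sym (count-reject too-long))
              (run 4 (inj₂ (<⇒≢ a<base , len , read-length done doc rest′ split , Z , fit Z≤n , inj₁ (len<K , refl))) ◅◅ path)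
        where
        too-long : ¬ s IsSubstringOf doc
        too-long s⊑doc with substring⇒OccursAt s⊑doc
        ... | b , le , _ = <⇒≱ len<K (≤-trans (≤-reflexive (sym (length-substringAt docs X+K≤n)))
              (≤-trans (m≤n+m (length s) b) le))

      run-long : K ≤ len → ∀ l → Processed Y (count done) l
      run-long K≤len l₀@(loc _ _ _ _ i p j g) = finish (search g {i} {p} {j} (≤-trans (m≤m+n Y len) (≤-reflexive (sym E+K))))
        where
        E : ℕ
        E = Z ∸ K

        K≤Z : K ≤ Z
        K≤Z = ≤-trans K≤len (m≤n+m len Y)

        E+K : E + K ≡ Z
        E+K = m∸n+n≡m K≤Z

        f : Frame
        f = frame n base d h rest X ℓ best K a Y (count done) len Z E

        readable : Readable w input T f
        readable = record { fits = fits ; 4≤base = 4≤base ; read-T = read-T ; X+K≤n = X+K≤n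
          ; E+K≤n = ≤-trans (≤-reflexive E+K) Z≤n ; 1≤K = 1≤K }

        open Matching w input T f readable

        enter : at docL a Y (count done) l₀ ⟶[ 6 ] at resetL a Y (count done) (loc len Z E Y i p j g)
        enter = run 6 (inj₂ (<⇒≢ a<base , len , read-length done doc rest′ split , Z , fit Z≤n ,
          inj₂ (K≤len , E , sub-id w (small Z≤n) K≤Z ,
            Y , trans (sub-id w (small Z≤n) (m≤n+m len Y)) (m+n∸n≡m Y len) , refl)))

        finish : (∃[ t ] t + 200 * Y ≤ Φmax + 5 × Searched (at resetL a Y (count done) (loc len Z E Y i p j g)) t) →
          Processed Y (count done) l₀
        finish (t , t≤ , y′ , i′ , p′ , j′ , g′ , inj₁ ((q , Y≤q , q≤E , match) , path))
          with run-next {Y} {count done + 1} {E} {y′} {i′} {p′} {j′} g′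
        ... | g″ , path′ = 6 + (t + 5) , _ , cost-document t Y len K (E + K) E+K t≤ K≤len ,
              subst (λ c → _ ⟶[ 6 + (t + 5) ] at docL (a + 1) (Z + 0) c (loc len Z E y′ i′ p′ j′ g″))
                (sym (count-accept (match⇒substring docs done doc rest′ split X K X+K≤n q Y≤q
                  (≤-trans (+-monoˡ-≤ K q≤E) (≤-reflexive E+K)) match)))
                (enter ◅◅ path ◅◅ run 1 (count done + 1 , fit cnt+1≤n , refl) ◅◅ path′)
          where
          cnt+1≤n : count done + 1 ≤ n
          cnt+1≤n = ≤-trans (≤-reflexive (+-comm (count done) 1)) (≤-trans (s≤s (count≤ done)) (≤-trans done<m m≤n))
        finish (t , t≤ , y′ , i′ , p′ , j′ , g′ , inj₂ (no-match , path))
          with run-next {Y} {count done} {E} {y′} {i′} {p′} {j′} g′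
        ... | g″ , path′ = 6 + (t + 4) , _ ,
              ≤-trans (+-monoʳ-≤ 6 (+-monoʳ-≤ t (n≤1+n 4))) (cost-document t Y len K (E + K) E+K t≤ K≤len) ,
              subst (λ c → _ ⟶[ 6 + (t + 4) ] at docL (a + 1) (Z + 0) c (loc len Z E y′ i′ p′ j′ g″))
                (sym (count-reject absent)) (enter ◅◅ path ◅◅ path′)
          where
          absent : ¬ s IsSubstringOf doc
          absent s⊑doc with substring⇒match docs done doc rest′ split X K X+K≤n s⊑doc
          ... | q , Y≤q , q+K≤Z , match = no-match q Y≤q (+-cancelʳ-≤ K q E (≤-trans q+K≤Z (≤-reflexive (sym E+K)))) match

      run-document : ∀ {Y′ cnt} → Y′ ≡ Y → cnt ≡ count done → ∀ l → Processed Y′ cnt l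
      run-document refl refl l with len <? K
      ... | yes len<K = run-short len<K l
      ... | no len≮K = run-long (≮⇒≥ len≮K) l

    -- The register contents enter through equations because a round leaves values such as `a + 1`
    -- and `Z + 0`, which agree with those expected for `done ++ [ doc ]` only up to a proof.
    run-documents : ∀ done rest′ → docs ≡ done ++ rest′ → ∀ {a Y cnt} →
      a ≡ 4 + length done → Y ≡ totalLength done → cnt ≡ count done → ∀ l →
      ∃[ t ] ∃[ a′ ] ∃[ Y′ ] ∃[ l′ ] t ≤ 244 * totalLength rest′ + 16 * length rest′ + 1 ×
        at docL a Y cnt l ⟶[ t ] at countedL a′ Y′ (count docs) l′
    run-documents done [] split refl refl refl l = 1 , _ , _ , l , ≤-refl ,
      subst (λ ds → at docL (4 + length done) (totalLength done) (count done) l ⟶[ 1 ]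
                    at countedL (4 + length done) (totalLength done) (count ds) l)
        (sym split′) (run 1 (inj₁ (trans (+-comm 4 (length done)) (cong (λ ds → length ds + 4) (sym split′)) , refl)))
      where
      split′ : docs ≡ done
      split′ = trans split (++-identityʳ done)
    run-documents done (doc ∷ rest′) split refl eqY eqc l
      with Document.run-document done doc rest′ split eqY eqc l
    ... | t , l′ , t≤ , path
      with run-documents (done ++ [ doc ]) rest′ (trans split (sym (++-assoc done [ doc ] rest′)))
             {4 + length done + 1} {totalLength done + length doc + 0}
             (trans (+-assoc 4 (length done) 1) (cong (4 +_) (sym (length-++ done))))
             (trans (+-assoc (totalLength done) (length doc) 0) (sym (trans (totalLength-++ done [ doc ])
               (cong (totalLength done +_) (length-++ doc)))))
             refl l′
    ...   | t′ , a′ , Y′ , l″ , t′≤ , path′ = t + t′ , a′ , Y′ , l″ ,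
            subst (λ z → t + t′ ≤ 244 * z + 16 * suc (length rest′) + 1) (sym (length-++ doc))
              (cost-documents (length doc) (length rest′) t (totalLength rest′) t≤ t′ t′≤) ,
            path ◅◅ path′

  Occurs : ℕ → ℕ → Set
  Occurs q L = OccursInAtLeast d docs (substringAt docs (q , L))

  Occurs-shorten : ∀ {q L L′} → L ≤ L′ → q + L′ ≤ n → Occurs q L′ → Occurs q L
  Occurs-shorten {q} {L} L≤L′ q+L′≤n = OccursInAtLeast-mono docs d (window-substring docs
    (OccursAt-substringAt docs q+L′≤n) ≤-refl (+-monoʳ-≤ q (≤-trans L≤L′ (≤-reflexive (sym (length-substringAt docs q+L′≤n))))))

  -- Each question moves `h` from `rest` to `X` or to `ℓ`. Since `failed` covers every length from
  -- `ℓ + h` on, it survives the growth of `ℓ`. Its guard `q′ * h + L ≤ n` keeps out windows that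
  -- `substringAt` would truncate at the end of the text.
  record Progress (rest X ℓ best : ℕ) : Set where
    field
      q        : ℕ
      X≡q*h    : X ≡ q * h
      split    : X + ℓ + rest ≡ n
      best+ℓ≤n : best + ℓ ≤ n
      occurs   : Occurs best ℓ
      failed   : ∀ q′ L → q′ * h < X → ℓ + h ≤ L → q′ * h + L ≤ n → ¬ Occurs (q′ * h) L

  1≤h : 1 ≤ h
  1≤h = m≥n⇒m/n>0 (+-monoˡ-≤ 1 1≤τ)

  module Step {rest X ℓ best : ℕ} (progress : Progress rest X ℓ best) (h≤rest : h ≤ rest) where
    open Progress progress

    K : ℕ
    K = ℓ + h

    rest≤n : rest ≤ n
    rest≤n = ≤-trans (m≤n+m rest (X + ℓ)) (≤-reflexive split)

    X+K≤n : X + K ≤ n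
    X+K≤n = ≤-trans (≤-reflexive (sym (+-assoc X ℓ h))) (≤-trans (+-monoʳ-≤ (X + ℓ) h≤rest) (≤-reflexive split))

    X+h+ℓ : X + h + ℓ ≡ X + K
    X+h+ℓ = trans (+-assoc X h ℓ) (cong (X +_) (+-comm h ℓ))

    X+K+rest : X + K + (rest ∸ h) ≡ n
    X+K+rest = trans (cong (_+ (rest ∸ h)) (sym (+-assoc X ℓ h))) (trans (+-assoc (X + ℓ) h (rest ∸ h))
      (trans (cong (X + ℓ +_) (m+[n∸m]≡n h≤rest)) split))

    open Check (rest ∸ h) X ℓ best K X+K≤n (≤-trans 1≤h (m≤n+m h ℓ)) using (run-documents; count)

    Stepped : State → ℕ → Set
    Stepped s t = ∃[ X′ ] ∃[ ℓ′ ] ∃[ best′ ] ∃[ a ] ∃[ Y ] ∃[ cnt ] ∃[ l ]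
      Progress (rest ∸ h) X′ ℓ′ best′ × s ⟶[ t ] state outerL (rest ∸ h) X′ ℓ′ best′ K a Y cnt l

    run-counted : ∀ {a Y} l → ∃[ t ] t ≤ 5 × Stepped (state countedL (rest ∸ h) X ℓ best K a Y (count docs) l) t
    run-counted {a} {Y} l with count docs <? d
    ... | yes cnt<d = 3 , m≤m+n 3 2 , X + h , ℓ , best , a , Y , _ , l ,
          record
            { q = suc q
            ; X≡q*h = trans (+-comm X h) (cong (h +_) X≡q*h)
            ; split = trans (cong (_+ (rest ∸ h)) X+h+ℓ) X+K+rest
            ; best+ℓ≤n = best+ℓ≤n
            ; occurs = occurs
            ; failed = failed′ } ,
          run 3 (inj₁ (cnt<d , X + h , fit X+h≤n , refl))
      where
      X+h≤n : X + h ≤ n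
      X+h≤n = ≤-trans (m≤m+n (X + h) ℓ) (≤-trans (≤-reflexive X+h+ℓ) X+K≤n)

      failed′ : ∀ q′ L → q′ * h < X + h → K ≤ L → q′ * h + L ≤ n → ¬ Occurs (q′ * h) L
      failed′ q′ L q′h< K≤L le occurs′ with q′ * h <? X
      -- Earlier samples were rejected before. The only new one is `X` itself, where a longer window
      -- that occurs often enough would make its prefix of length `K` do so too.
      ... | yes q′h<X = failed q′ L q′h<X K≤L le occurs′
      ... | no q′h≮X = <⇒≱ cnt<d (Occurs-shorten K≤L (subst (λ z → z + L ≤ n) q′h≡X le)
              (subst (λ z → Occurs z L) q′h≡X occurs′))
        where
        q′≤q : q′ ≤ q
        q′≤q = s≤s⁻¹ (*-cancelʳ-< h q′ (suc q) (subst (q′ * h <_) (trans (+-comm X h) (cong (h +_) X≡q*h)) q′h<))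
        q′h≡X : q′ * h ≡ X
        q′h≡X = ≤-antisym (≤-trans (*-monoˡ-≤ h q′≤q) (≤-reflexive (sym X≡q*h))) (≮⇒≥ q′h≮X)
    ... | no cnt≮d = 5 , ≤-refl , X , K + 0 , X + 0 , a , Y , _ , _ ,
          subst₂ (Progress (rest ∸ h) X) (sym (+-identityʳ K)) (sym (+-identityʳ X)) (record
            { q = q
            ; X≡q*h = X≡q*h
            ; split = X+K+rest
            ; best+ℓ≤n = X+K≤n
            ; occurs = ≮⇒≥ cnt≮d
            ; failed = λ q′ L q′h<X K+h≤L → failed q′ L q′h<X (≤-trans (m≤m+n K h) K+h≤L) }) ,
          run 5 (inj₂ (≮⇒≥ cnt≮d , 0 , fit z≤n ,
            K + 0 , fit (≤-trans (≤-reflexive (+-identityʳ K)) (m+n≤o⇒n≤o X X+K≤n)) ,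
            X + 0 , fit (≤-trans (≤-reflexive (+-identityʳ X)) (m+n≤o⇒m≤o X X+K≤n)) , refl))

    run-iteration : ∀ {K₀ a Y cnt} l → ∃[ t ] t ≤ 260 * n + 12 × Stepped (state outerL rest X ℓ best K₀ a Y cnt l) t
    run-iteration l with run-documents [] docs refl refl refl refl l
    ... | t , a′ , Y′ , l′ , t≤ , path with run-counted {a′} {Y′} l′
    ...   | t′ , t′≤ , X′ , ℓ′ , best′ , a″ , Y″ , cnt″ , l″ , progress′ , path′ =
            6 + (t + t′) , ≤-trans (+-monoʳ-≤ 6 (+-monoʳ-≤ t t′≤)) (cost-iteration t n m t≤ m≤n) ,
            X′ , ℓ′ , best′ , a″ , Y″ , cnt″ , l″ , progress′ , (enter ◅◅ path ◅◅ path′)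
      where
      enter : state outerL rest X ℓ best _ _ _ _ l ⟶[ 6 ] state docL (rest ∸ h) X ℓ best K 4 0 0 l
      enter = run 6 (inj₂ (h≤rest , rest ∸ h , sub-id w (small rest≤n) h≤rest ,
        K , fit (m+n≤o⇒n≤o X X+K≤n) , 4 , fit-4 , 0 , fit z≤n , 0 , fit z≤n , refl))

  Outcome : State → ℕ → ℕ → Set
  Outcome s rest t = ∃[ k ] ∃[ rest′ ] ∃[ X ] ∃[ ℓ ] ∃[ best ]
    k * h ≤ rest × t ≤ k * (260 * n + 12) + 2 × rest′ < h × Progress rest′ X ℓ best ×
    _⇓[_]_ w program input s t (best , ℓ)

  Outcome-halt : ∀ {rest X ℓ best K a Y cnt} l → Progress rest X ℓ best → rest < h →
    Outcome (state outerL rest X ℓ best K a Y cnt l) rest 2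
  Outcome-halt {rest} {X} {ℓ} {best} l progress rest<h = 0 , rest , X , ℓ , best , z≤n , ≤-refl , rest<h , progress ,
    ⟶-⇓ (run 1 (inj₁ (rest<h , refl))) (halts refl)

  Outcome-step : ∀ {s s′ rest t t′} → h ≤ rest → t ≤ 260 * n + 12 → s ⟶[ t ] s′ →
    Outcome s′ (rest ∸ h) t′ → Outcome s rest (t + t′)
  Outcome-step {rest = rest} h≤rest t≤ path (k , rest′ , X , ℓ , best , kh≤ , t′≤ , rest′<h , progress , run′) =
    suc k , rest′ , X , ℓ , best ,
    ≤-trans (+-monoʳ-≤ h kh≤) (≤-reflexive (m+[n∸m]≡n h≤rest)) ,
    ≤-trans (+-mono-≤ t≤ t′≤) (≤-reflexive (sym (+-assoc (260 * n + 12) (k * (260 * n + 12)) 2))) ,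
    rest′<h , progress , ⟶-⇓ path run′

  run-outer : ∀ fuel {rest X ℓ best K a Y cnt} l → Progress rest X ℓ best → rest < fuel →
    ∃[ t ] Outcome (state outerL rest X ℓ best K a Y cnt l) rest t
  run-outer (suc fuel) {rest} {X} {ℓ} {best} {K} {a} {Y} {cnt} l progress (s≤s rest≤fuel) = choose (h ≤? rest)
    where
    s : State
    s = state outerL rest X ℓ best K a Y cnt l

    continue : (h≤rest : h ≤ rest) → (∃[ t ] t ≤ 260 * n + 12 × Step.Stepped progress h≤rest s t) → ∃[ t ] Outcome s rest t
    continue h≤rest (t , t≤ , _ , _ , _ , _ , _ , _ , l′ , progress′ , path) =
      let t′ , outcome = run-outer fuel l′ progress′ (<-≤-trans (∸-monoʳ-< 1≤h h≤rest) rest≤fuel)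
      in t + t′ , Outcome-step h≤rest t≤ path outcome

    choose : Dec (h ≤ rest) → ∃[ t ] Outcome s rest t
    choose (no h≰rest)  = 2 , Outcome-halt l progress (≰⇒> h≰rest)
    choose (yes h≤rest) = continue h≤rest (Step.run-iteration progress h≤rest l)

-- Initialisation, approximation and total cost

module _ (docs : Docs) (d τ w : ℕ) (m≤n : length docs ≤ totalLength docs) (1≤τ : 1 ≤ τ) (τ≤n : τ ≤ totalLength docs)
  (addressable : length (encode docs d τ) ≤ 2 ^ w) (d≤m : d ≤ length docs) where

  open Algorithm docs d τ w m≤n 1≤τ τ≤n addressable
  open Exec w program input

  run-initialise : ∃[ l ] ⟨ 0 , replicate 25 0 ⟩ ⟶[ 14 ] state outerL n 0 0 0 0 0 0 0 l
  run-initialise = loc 0 0 0 0 0 0 0 (scratch 0 0 0 0 0) , run 14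
    ( 1 , fit-const (s≤s (s≤s z≤n)) , n , refl , n , refl , m , refl , 2 , fit-const (s≤s (s≤s (s≤s z≤n))) , d , refl
    , 3 , fit-const ≤-refl , τ , refl , 4 , fit-4 , base , truncate-id w (below base<base+n) , τ + 1
    , truncate-id w τ+1<2^w , 2 , fit-const (s≤s (s≤s (s≤s z≤n))) , h , div-id w τ+1<2^w , 0 , fit z≤n , refl )
    where
    τ+1<2^w : τ + 1 < 2 ^ w
    τ+1<2^w = below (≤-<-trans (+-monoˡ-≤ 1 τ≤n) (subst (_< base + n) (+-comm 1 n)
      (+-monoˡ-< n (<-≤-trans (s≤s (s≤s z≤n)) (m≤n+m 4 m)))))

  Progress-start : Progress n 0 0 0
  Progress-start = record
    { q = 0 ; X≡q*h = refl ; split = refl ; best+ℓ≤n = z≤n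
    -- The initial output is the empty string, which occurs in all documents.
    ; occurs = ≤-trans d≤m (≤-reflexive (sym (cong length (filter-all ([] isSubstringOf?_)
        (universal (λ s → OccursAt⇒substring 0 [] s (z≤n , λ _ ())) docs)))))
    ; failed = λ _ _ () }

  module _ (1≤d : 1 ≤ d) {rest X ℓ best : ℕ} (progress : Progress rest X ℓ best) (rest<h : rest < h) where
    open Progress progress

    -- If the string were longer, the window inside it would either start at a rejected sample,
    -- against `failed`, or start at `X` or later, where only `ℓ + rest < ℓ + h` letters remain.
    approximates : ∀ lcs → OccursInAtLeast d docs lcs → length lcs + 1 ≤ ℓ + τ
    approximates lcs occ with length lcs <? ℓ + τ
    ... | yes lt′ = ≤-trans (≤-reflexive (+-comm (length lcs) 1)) lt′
    ... | no ≮ with substring⇒OccursAt (Occurs⇒substring-concat docs lcs (≤-trans 1≤d occ))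
    ...   | p , at@(p+L≤n , _) = ⊥-elim (contradict (q′ * h <? X))
      where
      instance
        h≢0 : NonZero h
        h≢0 = >-nonZero 1≤h

      -- The quotient p / h rounded up, so that `q′ * h` is the first sample at or after `p`.
      q′ : ℕ
      q′ = (p + pred h) / h

      p≤q′h : p ≤ q′ * h
      p≤q′h = +-cancelʳ-≤ (pred h) p (q′ * h) (≤-trans (≤-reflexive (m≡m%n+[m/n]*n (p + pred h) h))
        (≤-trans (+-monoˡ-≤ (q′ * h) (<⇒≤pred (m%n<n (p + pred h) h))) (≤-reflexive (+-comm (pred h) (q′ * h)))))

      q′h+1≤p+h : q′ * h + 1 ≤ p + h
      q′h+1≤p+h = ≤-trans (+-monoˡ-≤ 1 (m/n*n≤m (p + pred h) h)) (≤-reflexive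
        (trans (+-assoc p (pred h) 1) (cong (p +_) (trans (+-comm (pred h) 1) (suc-pred h)))))

      window≤ : q′ * h + (ℓ + h) ≤ p + length lcs
      window≤ = window-fits (q′ * h) h p ℓ τ (length lcs) q′h+1≤p+h (m/n*n≤m (τ + 1) 2) (≮⇒≥ ≮)

      window : Occurs (q′ * h) (ℓ + h)
      window = OccursInAtLeast-mono docs d (window-substring docs at p≤q′h window≤) occ

      contradict : Dec (q′ * h < X) → ⊥
      contradict (yes q′h<X) = failed q′ (ℓ + h) q′h<X ≤-refl (≤-trans window≤ p+L≤n) window
      contradict (no q′h≮X) = <⇒≱ (+-monoʳ-< (X + ℓ) rest<h) (≤-trans (≤-reflexive (+-assoc X ℓ h))
        (≤-trans (+-monoˡ-≤ (ℓ + h) (≮⇒≥ q′h≮X)) (≤-trans window≤ (≤-trans p+L≤n (≤-reflexive (sym split))))))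

  τ≤2h : τ ≤ h * 2
  τ≤2h = +-cancelʳ-≤ 1 τ (h * 2) (≤-trans (≤-reflexive (m≡m%n+[m/n]*n (τ + 1) 2))
    (≤-trans (+-monoˡ-≤ (h * 2) (s≤s⁻¹ (m%n<n (τ + 1) 2))) (≤-reflexive (+-comm 1 (h * 2)))))

  Correct : Set
  Correct = ∃[ t ] ∃[ b ] ∃[ ℓ ]
    ( Computes w program (encode docs d τ) 25 t (b , ℓ)
    × t * τ ≤ 560 * (n * n)
    × b + ℓ ≤ n
    × OccursInAtLeast d docs (substringAt docs (b , ℓ))
    × (∀ lcs → IsLCS d docs lcs → length lcs + 1 ≤ length (substringAt docs (b , ℓ)) + τ))

  algorithm-correct : 1 ≤ d → Correct
  algorithm-correct 1≤d = conclude (proj₂ run-initialise) (run-outer (suc n) (proj₁ run-initialise) Progress-start ≤-refl)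
    where
    conclude : ∀ {s} → ⟨ 0 , replicate 25 0 ⟩ ⟶[ 14 ] s → (∃[ t ] Outcome s n t) → Correct
    conclude path (t , k , rest , X , ℓ , best , kh≤n , t≤ , rest<h , progress , run′) =
      14 + t , best , ℓ , ⟶-⇓ path run′ ,
      cost-total {k = k} {h} (≤-trans (+-monoʳ-≤ 14 t≤) (≤-reflexive (trans (+-comm 14 (k * (260 * n + 12) + 2))
        (+-assoc (k * (260 * n + 12)) 2 14)))) kh≤n τ≤2h τ≤n 1≤n ,
      best+ℓ≤n , occurs ,
      λ lcs isLCS → ≤-trans (approximates 1≤d progress rest<h lcs (proj₁ isLCS))
        (≤-reflexive (cong (_+ τ) (sym (length-substringAt docs best+ℓ≤n))))
      where open Progress progress

theorem1 : ∀ (c κ : ℕ) →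
    ∃[ P ] ∃[ S ] ∃[ C ]
    (∀ (docs : Docs) (σ d τ w : ℕ) →
    let n = totalLength docs
        m = length docs
    in
    All (All (λ a → 1 ≤ a × a ≤ σ)) docs →
    σ ≤ n ^ c →
    m ≤ n →
    2 ≤ d → d ≤ m →
    1 ≤ τ → τ ≤ n →
    WordSize κ σ w docs d τ →
    ∃[ t ] ∃[ b ] ∃[ ℓ ]
    ( Computes w P (encode docs d τ) S t (b , ℓ)
    × t * τ ≤ C * (n * n)
    × b + ℓ ≤ n
    × OccursInAtLeast d docs (substringAt docs (b , ℓ))
    × (∀ lcs → IsLCS d docs lcs →
    length lcs + 1 ≤ length (substringAt docs (b , ℓ)) + τ)))
theorem1 c κ = program , 25 , 560 , λ docs σ d τ w _ _ m≤n 2≤d d≤m 1≤τ τ≤n (addressable , _) →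
  algorithm-correct docs d τ w m≤n 1≤τ τ≤n addressable d≤m (≤-trans (n≤1+n 1) 2≤d)
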